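{- For all integers $n,r$ with $n\ge 2$ and $n>r\ge 1$, $$S(n,r)=\zeta(n),$$ where $S(n,r)$ is the sum of all multiple zeta values of weight $n$ and depth $r$, i.e. $$S(n,r)=\sum_{\substack{k_1+\dots+k_r=n\\ k_1\ge 2,\ k_2,\dots,k_r\ge 1}}\zeta(k_1,\dots,k_r).$$
   Context: For integers $k_1\ge 2$, $k_2,\dots,k_r\ge 1$, the multiple zeta value is $\zeta(k_1,\dots,k_r)=\sum_{n_1>n_2>\dots>n_r>0}\frac{1}{n_1^{k_1}n_2^{k_2}\cdots n_r^{k_r}}$. Its weight is $k_1+\dots+k_r$ and its depth is $r$. $\zeta(n)=\sum_{k\ge1}k^{ -n}$. -}

module Defs where

open import Data.Empty using (⊥)
open import Data.Integer.Base as ℤ using (+_; +[1+_])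
import Data.Integer.Properties as ℤₚ
open import Data.List.Base using (List; []; _∷_; map; concatMap; upTo; foldr)
open import Data.List.Membership.Propositional using (_∈_; lose; find)
open import Data.List.Membership.Propositional.Properties
  using (∈-map⁺; ∈-map⁻; ∈-concatMap⁺; ∈-concatMap⁻; ∈-upTo⁺; ∈-upTo⁻)
open import Data.List.Relation.Binary.Disjoint.Propositional using (Disjoint)
open import Data.List.Relation.Unary.All as All using (All; []; _∷_)
import Data.List.Relation.Unary.All.Properties as All
open import Data.List.Relation.Unary.AllPairs as AllPairs using ([]; _∷_)
import Data.List.Relation.Unary.AllPairs.Properties as AllPairs
open import Data.List.Relation.Unary.Any using (here)
open import Data.List.Relation.Unary.Unique.Propositional using (Unique)
import Data.List.Relation.Unary.Unique.Propositional.Properties as Unique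
open import Data.Nat.Base as ℕ using (ℕ; zero; suc; z≤n; s≤s)
import Data.Nat.Properties as ℕₚ
open import Data.Product.Base using (∃-syntax; _×_; _,_; proj₁; proj₂)
open import Data.Rational.Base
open import Data.Rational.Properties
open import Data.Rational.Solver using (module +-*-Solver)
import Data.Rational.Unnormalised.Base as ℚᵘ
import Data.Rational.Unnormalised.Properties as ℚᵘₚ
open import Data.Sum.Base using (inj₁; inj₂)
open import Data.Vec.Base as Vec using (Vec; []; _∷_)
open import Data.Vec.Properties using (∷-injective)
open import Data.Vec.Relation.Unary.All as VecAll using ([]; _∷_)
open import Function.Base using (_∘_)
open import Relation.Binary.PropositionalEquality

------------------------------------------------------------------------
-- Real numbers as Cauchy sequences of rationals.  A Cauchy sequence of
-- rationals represents its own limit, so the value of a convergent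
-- series of rationals is the sequence of its partial sums.

IsCauchy : (ℕ → ℚ) → Set
IsCauchy x = ∀ ε → 0ℚ < ε →
  ∃[ N ] (∀ m n → N ℕ.≤ m → N ℕ.≤ n → ∣ x m - x n ∣ < ε)

record ℝ : Set where
  constructor real
  field
    seq    : ℕ → ℚ
    cauchy : IsCauchy seq

open ℝ public

infix 4 _≈ℝ_

_≈ℝ_ : ℝ → ℝ → Set
x ≈ℝ y = ∀ ε → 0ℚ < ε →
  ∃[ N ] (∀ n → N ℕ.≤ n → ∣ seq x n - seq y n ∣ < ε)

private
  open +-*-Solver

  0<½ε : ∀ {ε} → 0ℚ < ε → 0ℚ < ½ * ε
  0<½ε {ε} 0<ε = positive⁻¹ _ {{pos*pos⇒pos ½ ε {{positive 0<ε}}}}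

  +-isCauchy : ∀ {x y} → IsCauchy x → IsCauchy y → IsCauchy (λ n → x n + y n)
  +-isCauchy {x} {y} cx cy ε 0<ε with cx (½ * ε) (0<½ε 0<ε) | cy (½ * ε) (0<½ε 0<ε)
  ... | M , hx | N , hy = M ℕ.⊔ N , λ m n m≥ n≥ → begin-strict
    ∣ (x m + y m) - (x n + y n) ∣
      ≡⟨ cong ∣_∣ (solve 4 (λ a b c d → (a :+ b) :- (c :+ d) := (a :- c) :+ (b :- d))
                    refl (x m) (y m) (x n) (y n)) ⟩
    ∣ (x m - x n) + (y m - y n) ∣
      ≤⟨ ∣p+q∣≤∣p∣+∣q∣ (x m - x n) (y m - y n) ⟩
    ∣ x m - x n ∣ + ∣ y m - y n ∣
      <⟨ +-mono-< (hx m n (ℕₚ.m⊔n≤o⇒m≤o M N m≥) (ℕₚ.m⊔n≤o⇒m≤o M N n≥))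
                  (hy m n (ℕₚ.m⊔n≤o⇒n≤o M N m≥) (ℕₚ.m⊔n≤o⇒n≤o M N n≥)) ⟩
    ½ * ε + ½ * ε
      ≡⟨ solve 1 (λ e → con ½ :* e :+ con ½ :* e := e) refl ε ⟩
    ε ∎
    where open ≤-Reasoning

  0-isCauchy : IsCauchy (λ _ → 0ℚ)
  0-isCauchy ε 0<ε = 0 , λ _ _ _ _ → 0<ε

infixl 6 _+ℝ_

0ℝ : ℝ
0ℝ = real (λ _ → 0ℚ) 0-isCauchy

_+ℝ_ : ℝ → ℝ → ℝ
x +ℝ y = real (λ n → seq x n + seq y n) (+-isCauchy {seq x} {seq y} (cauchy x) (cauchy y))

sumℝ : List ℝ → ℝ
sumℝ = foldr _+ℝ_ 0ℝ

------------------------------------------------------------------------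

-- The empty index is not admissible: depth is at least 1.
Admissible : ∀ {r} → Vec ℕ r → Set
Admissible []       = ⊥
Admissible (k ∷ ks) = 2 ℕ.≤ k × VecAll.All (1 ℕ.≤_) ks

-- recipPow i k = 1 / (i+1)^k
recipPow : ℕ → ℕ → ℚ
recipPow i k = (+ 1 / (suc i ℕ.^ k)) {{ℕₚ.m^n≢0 (suc i) k}}

-- sumBelow f N = f 0 + … + f (N-1)
sumBelow : (ℕ → ℚ) → ℕ → ℚ
sumBelow f zero    = 0ℚ
sumBelow f (suc N) = sumBelow f N + f N

-- truncated (k₁,…,kᵣ) N is the sum of 1/(n₁^k₁⋯nᵣ^kᵣ) over all
-- N ≥ n₁ > n₂ > … > nᵣ > 0.  The outer variable is n₁ = i + 1, so that
-- n₁ > n₂ means i ≥ n₂.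
truncated : ∀ {r} → Vec ℕ r → ℕ → ℚ
truncated []       N = 1ℚ
truncated (k ∷ ks) N = sumBelow (λ i → recipPow i k * truncated ks i) N

------------------------------------------------------------------------
-- Convergence.  With P N = ∏_{i≤N} (1 + 1/(2i)) one has
-- truncated ks N ≤ 2^d P N for every index ks of depth d with positive
-- entries.  The series for an admissible index is then dominated by a
-- telescoping one, with tail after N at most a constant times P N/(N+1),
-- and (P N/(N+1))² ≤ 2/(N+1).

module Convergence where
  2ℚ 4ℚ ¼ : ℚ
  2ℚ = 1ℚ + 1ℚ
  4ℚ = 2ℚ + 2ℚ
  ¼  = ½ * ½

  *-monoˡ : ∀ {r p q} → 0ℚ ≤ r → p ≤ q → r * p ≤ r * q
  *-monoˡ {r} 0≤r = *-monoˡ-≤-nonNeg r {{nonNegative 0≤r}}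

  *-monoʳ : ∀ {r p q} → 0ℚ ≤ r → p ≤ q → p * r ≤ q * r
  *-monoʳ {r} 0≤r = *-monoʳ-≤-nonNeg r {{nonNegative 0≤r}}

  *-mono : ∀ {p q r s} → 0ℚ ≤ p → 0ℚ ≤ s → p ≤ q → r ≤ s → p * r ≤ q * s
  *-mono 0≤p 0≤s p≤q r≤s = ≤-trans (*-monoˡ 0≤p r≤s) (*-monoʳ 0≤s p≤q)

  0≤* : ∀ {p q} → 0ℚ ≤ p → 0ℚ ≤ q → 0ℚ ≤ p * q
  0≤* {p} {q} 0≤p 0≤q =
    nonNegative⁻¹ _ {{nonNeg*nonNeg⇒nonNeg p {{nonNegative 0≤p}} q {{nonNegative 0≤q}}}}

  0≤+ : ∀ {p q} → 0ℚ ≤ p → 0ℚ ≤ q → 0ℚ ≤ p + q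
  0≤+ = +-mono-≤

  p≤p+q : ∀ {p q} → 0ℚ ≤ q → p ≤ p + q
  p≤p+q {p} 0≤q = ≤-trans (≤-reflexive (sym (+-identityʳ p))) (+-monoʳ-≤ p 0≤q)

  0≤1 : 0ℚ ≤ 1ℚ
  0≤1 = nonNegative⁻¹ 1ℚ

  0≤½ : 0ℚ ≤ ½
  0≤½ = nonNegative⁻¹ ½

  0≤2 : 0ℚ ≤ 2ℚ
  0≤2 = nonNegative⁻¹ 2ℚ

  0≤4 : 0ℚ ≤ 4ℚ
  0≤4 = nonNegative⁻¹ 4ℚ

  square-cancel-< : ∀ {a b} → 0ℚ ≤ b → a * a < b * b → a < b
  square-cancel-< {a} {b} 0≤b a²<b² = ≰⇒> λ b≤a →
    <-irrefl refl (<-≤-trans a²<b² (*-mono 0≤b (≤-trans 0≤b b≤a) b≤a b≤a))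

  ι : ℕ → ℚ
  ι n = + n / 1

  recip : ℕ → ℚ
  recip i = + 1 / suc i

  toℚᵘ-/ : ∀ n d → toℚᵘ (n / suc d) ℚᵘ.≃ ℚᵘ.mkℚᵘ n d
  toℚᵘ-/ n d = toℚᵘ-fromℚᵘ (ℚᵘ.mkℚᵘ n d)

  /-mono-≤ : ∀ {m n d e} → m ℤ.* +[1+ e ] ℤ.≤ n ℤ.* +[1+ d ] → m / suc d ≤ n / suc e
  /-mono-≤ {m} {n} {d} {e} h = toℚᵘ-cancel-≤ (begin
    toℚᵘ (m / suc d)  ≃⟨ toℚᵘ-/ m d ⟩
    ℚᵘ.mkℚᵘ m d       ≤⟨ ℚᵘ.*≤* h ⟩
    ℚᵘ.mkℚᵘ n e       ≃⟨ ℚᵘₚ.≃-sym (toℚᵘ-/ n e) ⟩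
    toℚᵘ (n / suc e)  ∎)
    where open ℚᵘₚ.≤-Reasoning

  1/-anti-≤ : ∀ {a b} .{{_ : ℕ.NonZero a}} .{{_ : ℕ.NonZero b}} →
              a ℕ.≤ b → + 1 / b ≤ + 1 / a
  1/-anti-≤ {suc a} {suc b} a≤b =
    /-mono-≤ {+ 1} {+ 1} {b} {a} (ℤ.+≤+ (ℕₚ.+-monoˡ-≤ 0 a≤b))

  ι-suc : ∀ n → ι (suc n) ≡ ι n + 1ℚ
  ι-suc n = toℚᵘ-injective (begin
    toℚᵘ (ι (suc n))                        ≈⟨ toℚᵘ-/ (+ suc n) 0 ⟩
    ℚᵘ.mkℚᵘ (+ suc n) 0                     ≈⟨ ℚᵘ.*≡* (cong (ℤ._* + 1) (trans (cong +_ (ℕₚ.+-comm 1 n)) (sym (cong (ℤ._+ + 1) (ℤₚ.*-identityʳ (+ n)))))) ⟩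
    ℚᵘ.mkℚᵘ (+ n) 0 ℚᵘ.+ ℚᵘ.mkℚᵘ (+ 1) 0    ≈⟨ ℚᵘₚ.+-cong (ℚᵘₚ.≃-sym (toℚᵘ-/ (+ n) 0)) ℚᵘₚ.≃-refl ⟩
    toℚᵘ (ι n) ℚᵘ.+ toℚᵘ 1ℚ                 ≈⟨ ℚᵘₚ.≃-sym (toℚᵘ-homo-+ (ι n) 1ℚ) ⟩
    toℚᵘ (ι n + 1ℚ)                         ∎)
    where open ℚᵘₚ.≃-Reasoning

  recip-inverse : ∀ i → recip i * ι (suc i) ≡ 1ℚ
  recip-inverse i = toℚᵘ-injective (begin
    toℚᵘ (recip i * ι (suc i))                 ≈⟨ toℚᵘ-homo-* (recip i) (ι (suc i)) ⟩
    toℚᵘ (recip i) ℚᵘ.* toℚᵘ (ι (suc i))       ≈⟨ ℚᵘₚ.*-cong (toℚᵘ-/ (+ 1) i) (toℚᵘ-/ (+ suc i) 0) ⟩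
    ℚᵘ.mkℚᵘ (+ 1) i ℚᵘ.* ℚᵘ.mkℚᵘ (+ suc i) 0   ≈⟨ ℚᵘ.*≡* (trans (ℤₚ.*-identityʳ _) (cong (+_ ∘ suc) (trans (ℕₚ.+-identityʳ i) (sym (trans (ℕₚ.+-identityʳ _) (ℕₚ.*-identityʳ i)))))) ⟩
    toℚᵘ 1ℚ                                    ∎)
    where open ℚᵘₚ.≃-Reasoning

  recip-* : ∀ m n → recip m * recip n ≡ + 1 / (suc m ℕ.* suc n)
  recip-* m n = toℚᵘ-injective (begin
    toℚᵘ (recip m * recip n)                ≈⟨ toℚᵘ-homo-* (recip m) (recip n) ⟩
    toℚᵘ (recip m) ℚᵘ.* toℚᵘ (recip n)      ≈⟨ ℚᵘₚ.*-cong (toℚᵘ-/ (+ 1) m) (toℚᵘ-/ (+ 1) n) ⟩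
    ℚᵘ.mkℚᵘ (+ 1) m ℚᵘ.* ℚᵘ.mkℚᵘ (+ 1) n    ≈⟨ ℚᵘ.*≡* refl ⟩
    ℚᵘ.mkℚᵘ (+ 1) (n ℕ.+ m ℕ.* suc n)       ≈⟨ ℚᵘₚ.≃-sym (toℚᵘ-/ (+ 1) (n ℕ.+ m ℕ.* suc n)) ⟩
    toℚᵘ (+ 1 / (suc m ℕ.* suc n))          ∎)
    where open ℚᵘₚ.≃-Reasoning

  0≤recip : ∀ i → 0ℚ ≤ recip i
  0≤recip i = nonNegative⁻¹ _ {{normalize-nonNeg 1 (suc i)}}

  recip≤1 : ∀ i → recip i ≤ 1ℚ
  recip≤1 i = 1/-anti-≤ {1} {suc i} (s≤s z≤n)

  0≤ι : ∀ n → 0ℚ ≤ ι n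
  0≤ι n = nonNegative⁻¹ _ {{normalize-nonNeg n 1}}

  recip-step : ∀ i → recip i ≡ recip i * recip (suc i) + recip (suc i)
  recip-step i = begin
    s                          ≡⟨ sym (*-identityʳ s) ⟩
    s * 1ℚ                     ≡⟨ cong (s *_) (sym (recip-inverse (suc i))) ⟩
    s * (t * ι (suc (suc i)))  ≡⟨ cong (λ z → s * (t * z)) (ι-suc (suc i)) ⟩
    s * (t * (n + 1ℚ))         ≡⟨ solve 3 (λ s t n → s :* (t :* (n :+ con 1ℚ)) := s :* t :+ t :* (s :* n)) refl s t n ⟩
    s * t + t * (s * n)        ≡⟨ cong (λ z → s * t + t * z) (recip-inverse i) ⟩
    s * t + t * 1ℚ             ≡⟨ cong (λ z → s * t + z) (*-identityʳ t) ⟩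
    s * t + t                  ∎
    where
    open ≡-Reasoning
    s = recip i
    t = recip (suc i)
    n = ι (suc i)

  recip≤2recip-suc : ∀ i → recip i ≤ 2ℚ * recip (suc i)
  recip≤2recip-suc i = begin
    s            ≡⟨ recip-step i ⟩
    s * t + t    ≤⟨ +-monoˡ-≤ t (*-monoʳ (0≤recip (suc i)) (recip≤1 i)) ⟩
    1ℚ * t + t   ≡⟨ solve 1 (λ t → con 1ℚ :* t :+ t := con 2ℚ :* t) refl t ⟩
    2ℚ * t       ∎
    where
    open ≤-Reasoning
    s = recip i
    t = recip (suc i)

  0≤recipPow : ∀ i k → 0ℚ ≤ recipPow i k
  0≤recipPow i k = nonNegative⁻¹ _ {{normalize-nonNeg 1 (suc i ℕ.^ k) {{ℕₚ.m^n≢0 (suc i) k}}}}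

  recipPow≤recip : ∀ i {k} → 1 ℕ.≤ k → recipPow i k ≤ recip i
  recipPow≤recip i {k} 1≤k = 1/-anti-≤ {suc i} {suc i ℕ.^ k} {{_}} {{ℕₚ.m^n≢0 (suc i) k}}
    (ℕₚ.≤-trans (ℕₚ.≤-reflexive (sym (ℕₚ.^-identityʳ (suc i)))) (ℕₚ.^-monoʳ-≤ (suc i) 1≤k))

  recipPow≤recip² : ∀ i {k} → 2 ℕ.≤ k → recipPow i k ≤ recip i * recip i
  recipPow≤recip² i {k} 2≤k = ≤-trans
    (1/-anti-≤ {suc i ℕ.* suc i} {suc i ℕ.^ k} {{_}} {{ℕₚ.m^n≢0 (suc i) k}}
      (ℕₚ.≤-trans
        (ℕₚ.≤-reflexive (cong (suc i ℕ.*_) (sym (ℕₚ.^-identityʳ (suc i)))))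
        (ℕₚ.^-monoʳ-≤ (suc i) 2≤k)))
    (≤-reflexive (sym (recip-* i i)))

  P : ℕ → ℚ
  P zero    = 1ℚ
  P (suc i) = P i * (1ℚ + ½ * recip i)

  1≤factor : ∀ i → 1ℚ ≤ 1ℚ + ½ * recip i
  1≤factor i = p≤p+q (0≤* 0≤½ (0≤recip i))

  0≤factor : ∀ i → 0ℚ ≤ 1ℚ + ½ * recip i
  0≤factor i = ≤-trans 0≤1 (1≤factor i)

  0≤P : ∀ N → 0ℚ ≤ P N
  0≤P zero    = 0≤1
  0≤P (suc N) = 0≤* (0≤P N) (0≤factor N)

  1≤P : ∀ N → 1ℚ ≤ P N
  1≤P zero    = ≤-refl
  1≤P (suc N) = *-mono 0≤1 (0≤factor N) (1≤P N) (1≤factor N)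

  pow2 : ℕ → ℚ
  pow2 zero    = 1ℚ
  pow2 (suc d) = 2ℚ * pow2 d

  powHalf : ℕ → ℚ
  powHalf zero    = 1ℚ
  powHalf (suc d) = ½ * powHalf d

  0≤pow2 : ∀ d → 0ℚ ≤ pow2 d
  0≤pow2 zero    = 0≤1
  0≤pow2 (suc d) = 0≤* 0≤2 (0≤pow2 d)

  0<powHalf : ∀ d → 0ℚ < powHalf d
  0<powHalf zero    = positive⁻¹ 1ℚ
  0<powHalf (suc d) = positive⁻¹ _ {{pos*pos⇒pos ½ (powHalf d) {{positive (0<powHalf d)}}}}

  0<pow2 : ∀ d → 0ℚ < pow2 d
  0<pow2 zero    = positive⁻¹ 1ℚ
  0<pow2 (suc d) = positive⁻¹ _ {{pos*pos⇒pos 2ℚ (pow2 d) {{positive (0<pow2 d)}}}}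

  pow2-powHalf : ∀ d → pow2 d * powHalf d ≡ 1ℚ
  pow2-powHalf zero    = refl
  pow2-powHalf (suc d) = trans
    (solve 2 (λ a b → (con 2ℚ :* a) :* (con ½ :* b) := a :* b) refl (pow2 d) (powHalf d))
    (pow2-powHalf d)

  0≤sumBelow : ∀ {f} → (∀ i → 0ℚ ≤ f i) → ∀ N → 0ℚ ≤ sumBelow f N
  0≤sumBelow 0≤f zero    = ≤-refl
  0≤sumBelow 0≤f (suc N) = 0≤+ (0≤sumBelow 0≤f N) (0≤f N)

  0≤truncated : ∀ {d} (ks : Vec ℕ d) N → 0ℚ ≤ truncated ks N
  0≤truncated []       N = 0≤1
  0≤truncated (k ∷ ks) N = 0≤sumBelow (λ i → 0≤* (0≤recipPow i k) (0≤truncated ks i)) N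

  truncated≤ : ∀ {d} (ks : Vec ℕ d) → VecAll.All (1 ℕ.≤_) ks →
               ∀ N → truncated ks N ≤ pow2 d * P N
  truncated≤ []       _ N = ≤-trans (1≤P N) (≤-reflexive (sym (*-identityˡ (P N))))
  truncated≤ {suc d} (k ∷ ks) (1≤k ∷ 1≤ks) zero    = 0≤* (0≤pow2 (suc d)) 0≤1
  truncated≤ {suc d} (k ∷ ks) (1≤k ∷ 1≤ks) (suc N) = begin
    truncated (k ∷ ks) N + recipPow N k * truncated ks N
      ≤⟨ +-mono-≤ (truncated≤ (k ∷ ks) (1≤k ∷ 1≤ks) N)
           (*-mono (0≤recipPow N k) (0≤* (0≤pow2 d) (0≤P N))
             (recipPow≤recip N 1≤k) (truncated≤ ks 1≤ks N)) ⟩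
    2ℚ * pow2 d * P N + recip N * (pow2 d * P N)
      ≡⟨ solve 3 (λ c p s → con 2ℚ :* c :* p :+ s :* (c :* p) :=
                            con 2ℚ :* c :* (p :* (con 1ℚ :+ con ½ :* s)))
           refl (pow2 d) (P N) (recip N) ⟩
    2ℚ * pow2 d * P (suc N) ∎
    where open ≤-Reasoning

  tail : ℕ → ℚ
  tail N = P N * recip N

  0≤tail : ∀ N → 0ℚ ≤ tail N
  0≤tail N = 0≤* (0≤P N) (0≤recip N)

  tail-step : ∀ i → recip i * recip i * P i + 4ℚ * tail (suc i) ≤ 4ℚ * tail i
  tail-step i = begin
    s * s * p + 4ℚ * (p * (1ℚ + ½ * s) * t)
      ≤⟨ +-monoˡ-≤ _ (*-monoʳ (0≤P i) (*-monoˡ (0≤recip i) (recip≤2recip-suc i))) ⟩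
    s * (2ℚ * t) * p + 4ℚ * (p * (1ℚ + ½ * s) * t)
      ≡⟨ solve 3 (λ p s t →
           s :* (con 2ℚ :* t) :* p :+ con 4ℚ :* (p :* (con 1ℚ :+ con ½ :* s) :* t) :=
           con 4ℚ :* (p :* (s :* t :+ t))) refl p s t ⟩
    4ℚ * (p * (s * t + t))
      ≡⟨ cong (λ z → 4ℚ * (p * z)) (sym (recip-step i)) ⟩
    4ℚ * (p * s) ∎
    where
    open ≤-Reasoning
    p = P i
    s = recip i
    t = recip (suc i)

  P²≤ : ∀ N → P N * P N ≤ 2ℚ * ι N + 1ℚ
  P²≤ zero    = ≤-refl
  P²≤ (suc N) = begin
    P N * f * (P N * f)
      ≡⟨ solve 2 (λ p f → p :* f :* (p :* f) := p :* p :* (f :* f)) refl (P N) f ⟩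
    P N * P N * (f * f)
      ≤⟨ *-monoʳ (0≤* (0≤factor N) (0≤factor N)) (P²≤ N) ⟩
    (2ℚ * ι N + 1ℚ) * (f * f)
      ≡⟨ solve 2 (λ n s → (con 2ℚ :* n :+ con 1ℚ) :* ((con 1ℚ :+ con ½ :* s) :* (con 1ℚ :+ con ½ :* s)) :=
           con 2ℚ :* n :+ con 1ℚ :+ (con 2ℚ :+ con ½ :* s) :* (s :* (n :+ con 1ℚ))
             :- s :- con ¼ :* (s :* s)) refl (ι N) s ⟩
    2ℚ * ι N + 1ℚ + (2ℚ + ½ * s) * (s * (ι N + 1ℚ)) - s - ¼ * (s * s)
      ≡⟨ cong (λ z → 2ℚ * ι N + 1ℚ + (2ℚ + ½ * s) * z - s - ¼ * (s * s))
           (trans (cong (s *_) (sym (ι-suc N))) (recip-inverse N)) ⟩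
    2ℚ * ι N + 1ℚ + (2ℚ + ½ * s) * 1ℚ - s - ¼ * (s * s)
      ≤⟨ p≤p+q (0≤+ (0≤* 0≤½ (0≤recip N)) (0≤* (0≤* 0≤½ 0≤½) (0≤* (0≤recip N) (0≤recip N)))) ⟩
    2ℚ * ι N + 1ℚ + (2ℚ + ½ * s) * 1ℚ - s - ¼ * (s * s) + (½ * s + ¼ * (s * s))
      ≡⟨ solve 2 (λ n s → con 2ℚ :* n :+ con 1ℚ :+ (con 2ℚ :+ con ½ :* s) :* con 1ℚ
             :- s :- con ¼ :* (s :* s) :+ (con ½ :* s :+ con ¼ :* (s :* s)) :=
           con 2ℚ :* (n :+ con 1ℚ) :+ con 1ℚ) refl (ι N) s ⟩
    2ℚ * (ι N + 1ℚ) + 1ℚ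
      ≡⟨ cong (λ z → 2ℚ * z + 1ℚ) (sym (ι-suc N)) ⟩
    2ℚ * ι (suc N) + 1ℚ ∎
    where
    open ≤-Reasoning
    s = recip N
    f = 1ℚ + ½ * s

  tail²≤ : ∀ N → tail N * tail N ≤ 2ℚ * recip N
  tail²≤ N = begin
    p * s * (p * s)
      ≡⟨ solve 2 (λ p s → p :* s :* (p :* s) := p :* p :* (s :* s)) refl p s ⟩
    p * p * (s * s)
      ≤⟨ *-monoʳ (0≤* (0≤recip N) (0≤recip N)) (≤-trans (P²≤ N) (p≤p+q 0≤1)) ⟩
    (2ℚ * ι N + 1ℚ + 1ℚ) * (s * s)
      ≡⟨ solve 2 (λ n s → (con 2ℚ :* n :+ con 1ℚ :+ con 1ℚ) :* (s :* s) :=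
           con 2ℚ :* s :* (s :* (n :+ con 1ℚ))) refl (ι N) s ⟩
    2ℚ * s * (s * (ι N + 1ℚ))
      ≡⟨ cong ((2ℚ * s) *_) (trans (cong (s *_) (sym (ι-suc N))) (recip-inverse N)) ⟩
    2ℚ * s * 1ℚ
      ≡⟨ *-identityʳ (2ℚ * s) ⟩
    2ℚ * s ∎
    where
    open ≤-Reasoning
    p = P N
    s = recip N

  0<* : ∀ {p q} → 0ℚ < p → 0ℚ < q → 0ℚ < p * q
  0<* {p} {q} 0<p 0<q = positive⁻¹ _ {{pos*pos⇒pos p {{positive 0<p}} q {{positive 0<q}}}}

  archimedean : ∀ δ → 0ℚ < δ → ∃[ N ] recip N < δ
  archimedean δ 0<δ = go δ (positive 0<δ)
    where
    go : ∀ δ → Positive δ → ∃[ N ] recip N < δ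
    go δ@(mkℚ +[1+ p ] q _) _ = suc q , toℚᵘ-cancel-< (begin-strict
      toℚᵘ (recip (suc q))  ≃⟨ toℚᵘ-/ (+ 1) (suc q) ⟩
      ℚᵘ.mkℚᵘ (+ 1) (suc q) <⟨ ℚᵘ.*<* (ℤ.+<+ lemma) ⟩
      toℚᵘ δ                ∎)
      where
      open ℚᵘₚ.≤-Reasoning
      lemma : 1 ℕ.* suc q ℕ.< suc p ℕ.* suc (suc q)
      lemma = ℕₚ.<-≤-trans (s≤s (ℕₚ.≤-reflexive (ℕₚ.*-identityˡ (suc q))))
                           (ℕₚ.m≤m+n (suc (suc q)) (p ℕ.* suc (suc q)))

  tail-small : ∀ η → 0ℚ < η → ∃[ N ] tail N < η
  tail-small η 0<η with archimedean (½ * (η * η)) (0<½ε (0<* 0<η 0<η))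
  ... | N , recip< = N , square-cancel-< (<⇒≤ 0<η) (begin-strict
    tail N * tail N    ≤⟨ tail²≤ N ⟩
    2ℚ * recip N       <⟨ *-monoʳ-<-pos 2ℚ recip< ⟩
    2ℚ * (½ * (η * η)) ≡⟨ solve 1 (λ e → con 2ℚ :* (con ½ :* e) := e) refl (η * η) ⟩
    η * η              ∎)
    where open ≤-Reasoning

  -- A nondecreasing x with x + c nonincreasing, c ≥ 0 and c small somewhere.
  squeeze : ∀ {x c : ℕ → ℚ} → (∀ n → 0ℚ ≤ c n) →
            (∀ n → x n ≤ x (suc n)) → (∀ n → x (suc n) + c (suc n) ≤ x n + c n) →
            (∀ ε → 0ℚ < ε → ∃[ N ] c N < ε) → IsCauchy x
  squeeze {x} {c} 0≤c up down small ε 0<ε with small ε 0<ε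
  ... | N , cN<ε = N , λ m n m≥ n≥ → ≤-<-trans (close (lower m≥) (upper m≥) (lower n≥) (upper n≥)) cN<ε
    where
    open ≤-Reasoning

    lower′ : ∀ {n} → N ℕ.≤′ n → x N ≤ x n
    lower′ (ℕ.≤′-reflexive refl) = ≤-refl
    lower′ (ℕ.≤′-step h)         = ≤-trans (lower′ h) (up _)

    upper′ : ∀ {n} → N ℕ.≤′ n → x n + c n ≤ x N + c N
    upper′ (ℕ.≤′-reflexive refl) = ≤-refl
    upper′ (ℕ.≤′-step h)         = ≤-trans (down _) (upper′ h)

    lower : ∀ {n} → N ℕ.≤ n → x N ≤ x n
    lower h = lower′ (ℕₚ.≤⇒≤′ h)

    upper : ∀ {n} → N ℕ.≤ n → x n ≤ x N + c N
    upper h = ≤-trans (p≤p+q (0≤c _)) (upper′ (ℕₚ.≤⇒≤′ h))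

    half : ∀ {a b u e} → u ≤ b → a ≤ u + e → a - b ≤ e
    half {a} {b} {u} {e} u≤b a≤ = begin
      a - b        ≤⟨ +-mono-≤ a≤ (neg-antimono-≤ u≤b) ⟩
      u + e - u    ≡⟨ solve 2 (λ u e → u :+ e :- u := e) refl u e ⟩
      e            ∎

    close : ∀ {a b u e} → u ≤ a → a ≤ u + e → u ≤ b → b ≤ u + e → ∣ a - b ∣ ≤ e
    close {a} {b} {u} {e} u≤a a≤ u≤b b≤ with ∣p∣≡p∨∣p∣≡-p (a - b)
    ... | inj₁ eq = ≤-trans (≤-reflexive eq) (half u≤b a≤)
    ... | inj₂ eq = ≤-trans
      (≤-reflexive (trans eq (solve 2 (λ a b → :- (a :- b) := b :- a) refl a b)))
      (half u≤a b≤)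

  truncated-isCauchy : ∀ {r} (ks : Vec ℕ r) → Admissible ks → IsCauchy (truncated ks)
  truncated-isCauchy {suc d} (k ∷ ks) (2≤k , 1≤ks) =
    squeeze {truncated (k ∷ ks)} {λ n → pow2 d * (4ℚ * tail n)}
      (λ n → 0≤* (0≤pow2 d) (0≤* 0≤4 (0≤tail n)))
      (λ n → p≤p+q (0≤* (0≤recipPow n k) (0≤truncated ks n)))
      down small
    where
    down : ∀ n → truncated (k ∷ ks) n + recipPow n k * truncated ks n + pow2 d * (4ℚ * tail (suc n))
               ≤ truncated (k ∷ ks) n + pow2 d * (4ℚ * tail n)
    down n = begin
      x + recipPow n k * truncated ks n + D * t′
        ≤⟨ +-monoˡ-≤ (D * t′) (+-monoʳ-≤ x
             (*-mono (0≤recipPow n k) (0≤* (0≤pow2 d) (0≤P n))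
               (recipPow≤recip² n 2≤k) (truncated≤ ks 1≤ks n))) ⟩
      x + s * s * (D * P n) + D * t′
        ≡⟨ solve 5 (λ x s D p t → x :+ s :* s :* (D :* p) :+ D :* t :=
                                  x :+ D :* (s :* s :* p :+ t)) refl x s D (P n) t′ ⟩
      x + D * (s * s * P n + t′)
        ≤⟨ +-monoʳ-≤ x (*-monoˡ (0≤pow2 d) (tail-step n)) ⟩
      x + D * (4ℚ * tail n) ∎
      where
      open ≤-Reasoning
      x = truncated (k ∷ ks) n
      s = recip n
      D = pow2 d
      t′ = 4ℚ * tail (suc n)

    small : ∀ ε → 0ℚ < ε → ∃[ N ] pow2 d * (4ℚ * tail N) < ε
    small ε 0<ε =
      let η       = ¼ * (powHalf d * ε)
          N , t<η = tail-small η (0<* (positive⁻¹ ¼) (0<* (0<powHalf d) 0<ε))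
      in N , rescale (tail N) t<η
      where
      rescale : ∀ t → t < ¼ * (powHalf d * ε) → pow2 d * (4ℚ * t) < ε
      rescale t t<η = begin-strict
        pow2 d * (4ℚ * t)
          <⟨ *-monoʳ-<-pos (pow2 d) {{positive (0<pow2 d)}} (*-monoʳ-<-pos 4ℚ t<η) ⟩
        pow2 d * (4ℚ * (¼ * (powHalf d * ε)))
          ≡⟨ solve 3 (λ D h e → D :* (con 4ℚ :* (con ¼ :* (h :* e))) := D :* h :* e)
               refl (pow2 d) (powHalf d) ε ⟩
        pow2 d * powHalf d * ε
          ≡⟨ cong (_* ε) (pow2-powHalf d) ⟩
        1ℚ * ε
          ≡⟨ *-identityˡ ε ⟩
        ε ∎
        where open ≤-Reasoning

  IsCauchy-resp : ∀ {x y} → (∀ n → x n ≡ y n) → IsCauchy x → IsCauchy y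
  IsCauchy-resp {x} {y} x≗y cx ε 0<ε with cx ε 0<ε
  ... | N , h = N , λ m n m≥ n≥ →
    subst₂ (λ a b → ∣ a - b ∣ < ε) (x≗y m) (x≗y n) (h m n m≥ n≥)

  zetaSum≡truncated : ∀ k N → truncated (k ∷ []) N ≡ sumBelow (λ i → recipPow i k) N
  zetaSum≡truncated k zero    = refl
  zetaSum≡truncated k (suc N) =
    cong₂ _+_ (zetaSum≡truncated k N) (*-identityʳ (recipPow N k))

------------------------------------------------------------------------

mzv : ∀ {r} (ks : Vec ℕ r) → Admissible ks → ℝ
mzv ks adm = real (truncated ks) (Convergence.truncated-isCauchy ks adm)

-- The series Σ 1/m^n over m ≥ 1, stated on its own rather than as a
-- multiple zeta value of depth 1.
zeta : (n : ℕ) → 2 ℕ.≤ n → ℝ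
zeta n 2≤n = real (sumBelow (λ i → recipPow i n))
  (IsCauchy-resp (zetaSum≡truncated n) (truncated-isCauchy (n ∷ []) (2≤n , [])))
  where open Convergence

------------------------------------------------------------------------

-- Splits off the first entry k, chosen from the list ks, and leaves
-- weight n ∸ k for the rest; k never exceeds n below.
prepend : ∀ {r} → List ℕ → (ℕ → List (Vec ℕ r)) → ℕ → List (Vec ℕ (suc r))
prepend ks rest n = concatMap (λ k → map (k ∷_) (rest (n ℕ.∸ k))) ks

-- Vectors of length r with entries ≥ 1 and sum n
compositions : (r n : ℕ) → List (Vec ℕ r)
compositions zero    zero    = [] ∷ []
compositions zero    (suc n) = []
compositions (suc r) n       = prepend (map (1 ℕ.+_) (upTo n)) (compositions r) n

-- Admissible vectors of length r and sum n; see ∈-indices⇒, ⇒∈-indices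
-- and indices-unique.
indices : (n r : ℕ) → List (Vec ℕ r)
indices n zero    = []
indices n (suc r) = prepend (map (2 ℕ.+_) (upTo (n ℕ.∸ 1))) (compositions r) n

∈-prepend⇒ : ∀ {r} ks (rest : ℕ → List (Vec ℕ r)) n {k v} →
             (k ∷ v) ∈ prepend ks rest n → k ∈ ks × v ∈ rest (n ℕ.∸ k)
∈-prepend⇒ ks rest n h with find (∈-concatMap⁻ (λ k → map (k ∷_) (rest (n ℕ.∸ k))) {xs = ks} h)
... | k , k∈ks , kv∈ with ∈-map⁻ (k ∷_) kv∈
... | v , v∈ , refl = k∈ks , v∈

⇒∈-prepend : ∀ {r} ks (rest : ℕ → List (Vec ℕ r)) n {k v} →
             k ∈ ks → v ∈ rest (n ℕ.∸ k) → (k ∷ v) ∈ prepend ks rest n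
⇒∈-prepend ks rest n {k} k∈ v∈ =
  ∈-concatMap⁺ (λ k → map (k ∷_) (rest (n ℕ.∸ k))) (lose k∈ (∈-map⁺ (k ∷_) v∈))

prepend-unique : ∀ {r} {ks} {rest : ℕ → List (Vec ℕ r)} n → Unique ks →
                 (∀ m → Unique (rest m)) → Unique (prepend ks rest n)
prepend-unique n ks! rest! = Unique.concat⁺
  (All.map⁺ (All.universal (λ k → Unique.map⁺ (proj₂ ∘ ∷-injective) (rest! (n ℕ.∸ k))) _))
  (AllPairs.map⁺ (AllPairs.map disjoint ks!))
  where
  disjoint : ∀ {j k xs ys} → j ≢ k → Disjoint (map (j ∷_) xs) (map (k ∷_) ys)
  disjoint j≢k (v∈ , v∈′) with ∈-map⁻ (_ ∷_) v∈ | ∈-map⁻ (_ ∷_) v∈′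
  ... | _ , _ , refl | _ , _ , eq = j≢k (proj₁ (∷-injective eq))

∈-compositions⇒ : ∀ r n {v} → v ∈ compositions r n →
                  VecAll.All (1 ℕ.≤_) v × Vec.sum v ≡ n
∈-compositions⇒ zero    zero    {[]}    _ = [] , refl
∈-compositions⇒ (suc r) n       {k ∷ v} h
  with ∈-prepend⇒ (map (1 ℕ.+_) (upTo n)) (compositions r) n h
... | k∈ , v∈ with ∈-map⁻ (1 ℕ.+_) k∈ | ∈-compositions⇒ r (n ℕ.∸ k) v∈
... | j , j∈ , refl | 1≤v , eq =
  (s≤s z≤n ∷ 1≤v) , trans (cong (k ℕ.+_) eq) (ℕₚ.m+[n∸m]≡n (∈-upTo⁻ j∈))

⇒∈-compositions : ∀ {r} {v : Vec ℕ r} → VecAll.All (1 ℕ.≤_) v →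
                  v ∈ compositions r (Vec.sum v)
⇒∈-compositions {v = []}        []              = here refl
⇒∈-compositions {v = suc j ∷ v} (s≤s z≤n ∷ 1≤v) =
  ⇒∈-prepend (map (1 ℕ.+_) (upTo (suc j ℕ.+ Vec.sum v))) (compositions _) _
    (∈-map⁺ (1 ℕ.+_) (∈-upTo⁺ (s≤s (ℕₚ.m≤m+n j (Vec.sum v)))))
    (subst (λ m → v ∈ compositions _ m) (sym (ℕₚ.m+n∸m≡n (suc j) (Vec.sum v)))
      (⇒∈-compositions 1≤v))

compositions-unique : ∀ r n → Unique (compositions r n)
compositions-unique zero    zero    = [] ∷ []
compositions-unique zero    (suc n) = []
compositions-unique (suc r) n       =
  prepend-unique n (Unique.map⁺ ℕₚ.suc-injective (Unique.upTo⁺ n)) (compositions-unique r)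

∈-indices⇒ : ∀ n r {v} → v ∈ indices n r → Admissible v × Vec.sum v ≡ n
∈-indices⇒ n (suc r) {k ∷ v} h
  with ∈-prepend⇒ (map (2 ℕ.+_) (upTo (n ℕ.∸ 1))) (compositions r) n h
... | k∈ , v∈ with ∈-map⁻ (2 ℕ.+_) k∈ | ∈-compositions⇒ r (n ℕ.∸ k) v∈
∈-indices⇒ (suc n) (suc r) {k ∷ v} h | k∈ , v∈ | j , j∈ , refl | 1≤v , eq =
  (s≤s (s≤s z≤n) , 1≤v) , trans (cong (k ℕ.+_) eq) (ℕₚ.m+[n∸m]≡n (s≤s (∈-upTo⁻ j∈)))
∈-indices⇒ zero (suc r) h | _ , _ | j , () , refl | _

⇒∈-indices : ∀ {r} {v : Vec ℕ r} → Admissible v → v ∈ indices (Vec.sum v) r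
⇒∈-indices {v = suc (suc j) ∷ v} (s≤s (s≤s z≤n) , 1≤v) =
  ⇒∈-prepend (map (2 ℕ.+_) (upTo (suc j ℕ.+ Vec.sum v))) (compositions _) _
    (∈-map⁺ (2 ℕ.+_) (∈-upTo⁺ (s≤s (ℕₚ.m≤m+n j (Vec.sum v)))))
    (subst (λ m → v ∈ compositions _ m) (sym (ℕₚ.m+n∸m≡n (suc (suc j)) (Vec.sum v)))
      (⇒∈-compositions 1≤v))

indices-unique : ∀ n r → Unique (indices n r)
indices-unique n zero    = []
indices-unique n (suc r) =
  prepend-unique n
    (Unique.map⁺ (ℕₚ.suc-injective ∘ ℕₚ.suc-injective) (Unique.upTo⁺ (n ℕ.∸ 1)))
    (compositions-unique r)

indices-admissible : ∀ n r → All Admissible (indices n r)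
indices-admissible n r = All.tabulate (proj₁ ∘ ∈-indices⇒ n r)

-- Sum of the multiple zeta values of weight n and depth r
S : (n r : ℕ) → ℝ
S n r = sumℝ (All.reduce (λ {ks} adm → mzv ks adm) (indices-admissible n r))

{-# OPTIONS --safe #-}

-- Collect the sums S n r into the power series R₀ in x and y in which the
-- truncation of S (a + b + 2) (b + 1) is the coefficient of x^a y^b, where
--
--   R_q = Σ_{1≤m≤M} 1/(m (q+m-x)) ∏_{1≤j<m} (j-x+y)/(j+q-x).
--
-- The difference R_q - R_{q+1} telescopes in m and equals
--
--   (1 - ∏_{1≤j≤M} (j-x+y)/(j+q+1-x)) / ((q+1-x)(q+1-y)).
--
-- Summing over q < N with M = N, the 1 contributes exactly the first N terms
-- of ζ(a + b + 2) to that coefficient; R_N and the products tend to 0.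

module Submission where

open import Defs
open import Data.Nat.Base using (ℕ; _≤_; _<_)

import Data.Integer.Base as ℤ
open import Data.List.Base using (List; []; _∷_; _++_; map; concatMap; upTo; applyUpTo)
open import Data.List.Properties using (map-upTo)
open import Data.List.Relation.Unary.All as All using (All; []; _∷_)
open import Data.Nat.Base as ℕ using (zero; suc; s≤s)
import Data.Nat.Properties as ℕₚ
open import Data.Product.Base using (∃-syntax; _,_)
open import Data.Rational.Base hiding (_≤_; _<_)
open import Data.Rational.Base as ℚ using ()
open import Data.Rational.Properties
open import Data.Rational.Solver using (module +-*-Solver)
open import Data.Vec.Base using (Vec; []; _∷_)
open import Function.Base using (_∘_; flip)
open import Relation.Binary.PropositionalEquality

open Convergence
open +-*-Solver

-- Finite sums

sumBelow-cong : ∀ {f g} → (∀ i → f i ≡ g i) → ∀ N → sumBelow f N ≡ sumBelow g N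
sumBelow-cong f≗g zero    = refl
sumBelow-cong f≗g (suc N) = cong₂ _+_ (sumBelow-cong f≗g N) (f≗g N)

sumBelow-+ : ∀ f g N → sumBelow (λ i → f i + g i) N ≡ sumBelow f N + sumBelow g N
sumBelow-+ f g zero    = refl
sumBelow-+ f g (suc N) = trans (cong (_+ (f N + g N)) (sumBelow-+ f g N))
  (solve 4 (λ a b c d → (a :+ b) :+ (c :+ d) := (a :+ c) :+ (b :+ d)) refl
    (sumBelow f N) (sumBelow g N) (f N) (g N))

sumBelow-*ˡ : ∀ c f N → sumBelow (λ i → c * f i) N ≡ c * sumBelow f N
sumBelow-*ˡ c f zero    = sym (*-zeroʳ c)
sumBelow-*ˡ c f (suc N) = trans (cong (_+ c * f N) (sumBelow-*ˡ c f N))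
  (sym (*-distribˡ-+ c (sumBelow f N) (f N)))

sumBelow-0 : ∀ {f} → (∀ i → f i ≡ 0ℚ) → ∀ N → sumBelow f N ≡ 0ℚ
sumBelow-0 f≗0 zero    = refl
sumBelow-0 f≗0 (suc N) = cong₂ _+_ (sumBelow-0 f≗0 N) (f≗0 N)

sumBelow-mono : ∀ {f g} → (∀ i → f i ℚ.≤ g i) → ∀ N → sumBelow f N ℚ.≤ sumBelow g N
sumBelow-mono f≤g zero    = ≤-refl
sumBelow-mono f≤g (suc N) = +-mono-≤ (sumBelow-mono f≤g N) (f≤g N)

∣sumBelow∣≤ : ∀ {f g} → (∀ i → ∣ f i ∣ ℚ.≤ g i) → ∀ N → ∣ sumBelow f N ∣ ℚ.≤ sumBelow g N
∣sumBelow∣≤ f≤g zero    = ≤-refl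
∣sumBelow∣≤ {f} f≤g (suc N) =
  ≤-trans (∣p+q∣≤∣p∣+∣q∣ (sumBelow f N) (f N)) (+-mono-≤ (∣sumBelow∣≤ f≤g N) (f≤g N))

sumOver : ∀ {A : Set} → (A → ℚ) → List A → ℚ
sumOver f []       = 0ℚ
sumOver f (x ∷ xs) = f x + sumOver f xs

sumOver-cong : ∀ {A : Set} {f g : A → ℚ} → (∀ x → f x ≡ g x) → ∀ xs → sumOver f xs ≡ sumOver g xs
sumOver-cong f≗g []       = refl
sumOver-cong f≗g (x ∷ xs) = cong₂ _+_ (f≗g x) (sumOver-cong f≗g xs)

sumOver-++ : ∀ {A : Set} (f : A → ℚ) xs ys → sumOver f (xs ++ ys) ≡ sumOver f xs + sumOver f ys
sumOver-++ f []       ys = sym (+-identityˡ _)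
sumOver-++ f (x ∷ xs) ys =
  trans (cong (f x +_) (sumOver-++ f xs ys)) (sym (+-assoc (f x) _ _))

sumOver-map : ∀ {A B : Set} (f : B → ℚ) (g : A → B) xs → sumOver f (map g xs) ≡ sumOver (f ∘ g) xs
sumOver-map f g []       = refl
sumOver-map f g (x ∷ xs) = cong (f (g x) +_) (sumOver-map f g xs)

sumOver-concatMap : ∀ {A B : Set} (f : B → ℚ) (g : A → List B) xs →
                    sumOver f (concatMap g xs) ≡ sumOver (sumOver f ∘ g) xs
sumOver-concatMap f g []       = refl
sumOver-concatMap f g (x ∷ xs) = trans (sumOver-++ f (g x) (concatMap g xs))
  (cong (sumOver f (g x) +_) (sumOver-concatMap f g xs))

sumOver-*ˡ : ∀ {A : Set} c (f : A → ℚ) xs → sumOver (λ x → c * f x) xs ≡ c * sumOver f xs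
sumOver-*ˡ c f []       = sym (*-zeroʳ c)
sumOver-*ˡ c f (x ∷ xs) = trans (cong (c * f x +_) (sumOver-*ˡ c f xs))
  (sym (*-distribˡ-+ c (f x) (sumOver f xs)))

sumOver-sumBelow : ∀ {A : Set} (f : A → ℕ → ℚ) N xs →
  sumOver (λ x → sumBelow (f x) N) xs ≡ sumBelow (λ i → sumOver (λ x → f x i) xs) N
sumOver-sumBelow f N []       = sym (sumBelow-0 (λ _ → refl) N)
sumOver-sumBelow f N (x ∷ xs) = trans (cong (sumBelow (f x) N +_) (sumOver-sumBelow f N xs))
  (sym (sumBelow-+ (f x) (λ i → sumOver (λ x → f x i) xs) N))

-- Power series in x and y, with f i j the coefficient of x^i y^j

Series : Set
Series = ℕ → ℕ → ℚ

infix 4 _≐_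

_≐_ : Series → Series → Set
f ≐ g = ∀ i j → f i j ≡ g i j

one : Series
one zero    zero    = 1ℚ
one zero    (suc j) = 0ℚ
one (suc i) j       = 0ℚ

-- Multiplication by x. `Y` is defined from it by swapping the indices, so that each fact about y
-- follows from the one about x.
X : Series → Series
X f zero    j = 0ℚ
X f (suc i) j = f i j

Y : Series → Series
Y f i j = X (flip f) j i

-- Division by k + 1 - x
divX : ℕ → Series → Series
divX k f zero    j = recip k * f zero j
divX k f (suc i) j = recip k * (f (suc i) j + divX k f i j)

-- Division by k + 1 - y
divY : ℕ → Series → Series
divY k f i j = divX k (flip f) j i

-- Multiplication by m + 1 - x + y
mulXY : ℕ → Series → Series
mulXY m f i j = ι (suc m) * f i j - X f i j + Y f i j

X-cong : ∀ {f g} → f ≐ g → X f ≐ X g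
X-cong f≐g zero    j = refl
X-cong f≐g (suc i) j = f≐g i j

Y-cong : ∀ {f g} → f ≐ g → Y f ≐ Y g
Y-cong f≐g i j = X-cong (λ i j → f≐g j i) j i

divX-cong : ∀ k {f g} → f ≐ g → divX k f ≐ divX k g
divX-cong k f≐g zero    j = cong (recip k *_) (f≐g zero j)
divX-cong k f≐g (suc i) j = cong (recip k *_) (cong₂ _+_ (f≐g (suc i) j) (divX-cong k f≐g i j))

divY-cong : ∀ k {f g} → f ≐ g → divY k f ≐ divY k g
divY-cong k f≐g i j = divX-cong k (λ i j → f≐g j i) j i

mulXY-cong : ∀ m {f g} → f ≐ g → mulXY m f ≐ mulXY m g
mulXY-cong m f≐g i j =
  cong₂ _+_ (cong₂ _-_ (cong (ι (suc m) *_) (f≐g i j)) (X-cong f≐g i j)) (Y-cong f≐g i j)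

-- The zero that `X` puts at x^0 merges the two clauses of `divX` into one recurrence, g = (f + x g)
-- / (k + 1).
divX-unfold : ∀ k f i j → divX k f i j ≡ recip k * (f i j + X (divX k f) i j)
divX-unfold k f zero    j = cong (recip k *_) (sym (+-identityʳ (f zero j)))
divX-unfold k f (suc i) j = refl

divX-inverse : ∀ k f i j → ι (suc k) * divX k f i j - X (divX k f) i j ≡ f i j
divX-inverse k f i j = begin
  a * divX k f i j - x       ≡⟨ cong (λ z → a * z - x) (divX-unfold k f i j) ⟩
  a * (s * (f i j + x)) - x  ≡⟨ solve 4 (λ a s f x → a :* (s :* (f :+ x)) :- x := (s :* a) :* (f :+ x) :- x) refl a s (f i j) x ⟩
  s * a * (f i j + x) - x    ≡⟨ cong (λ z → z * (f i j + x) - x) (recip-inverse k) ⟩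
  1ℚ * (f i j + x) - x       ≡⟨ solve 2 (λ f x → con 1ℚ :* (f :+ x) :- x := f) refl (f i j) x ⟩
  f i j                      ∎
  where
  open ≡-Reasoning
  a = ι (suc k)
  s = recip k
  x = X (divX k f) i j

-- The equation determines each coefficient from the one before it in x, since k + 1 is invertible.
-- Identities between quotients can thus be proved by clearing denominators.
divX-unique : ∀ k f g → (∀ i j → ι (suc k) * g i j - X g i j ≡ f i j) → g ≐ divX k f
divX-unique k f g h i j = begin
  g i j                                  ≡⟨ sym (*-identityˡ (g i j)) ⟩
  1ℚ * g i j                             ≡⟨ cong (_* g i j) (sym (recip-inverse k)) ⟩
  s * a * g i j                          ≡⟨ solve 4 (λ s a g x → s :* a :* g := s :* ((a :* g :- x) :+ x)) refl s a (g i j) (X g i j) ⟩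
  s * ((a * g i j - X g i j) + X g i j)  ≡⟨ cong₂ (λ u v → s * (u + v)) (h i j) (shifted i) ⟩
  s * (f i j + X (divX k f) i j)         ≡⟨ sym (divX-unfold k f i j) ⟩
  divX k f i j                           ∎
  where
  open ≡-Reasoning
  a = ι (suc k)
  s = recip k
  shifted : ∀ i → X g i j ≡ X (divX k f) i j
  shifted zero    = refl
  shifted (suc i) = divX-unique k f g h i j

divY-unique : ∀ k f g → (∀ i j → ι (suc k) * g i j - Y g i j ≡ f i j) → g ≐ divY k f
divY-unique k f g h i j = divX-unique k (flip f) (flip g) (λ i j → h j i) j i

divX-X : ∀ k f → divX k (X f) ≐ X (divX k f)
divX-X k f zero    j = *-zeroʳ (recip k)
divX-X k f (suc i) j =
  trans (cong (λ z → recip k * (f i j + z)) (divX-X k f i j)) (sym (divX-unfold k f i j))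

divX-Y : ∀ k f → divX k (Y f) ≐ Y (divX k f)
divX-Y k f zero    zero    = *-zeroʳ (recip k)
divX-Y k f zero    (suc j) = refl
divX-Y k f (suc i) zero    =
  trans (cong (λ z → recip k * (0ℚ + z)) (divX-Y k f i zero)) (*-zeroʳ (recip k))
divX-Y k f (suc i) (suc j) = cong (λ z → recip k * (f (suc i) j + z)) (divX-Y k f i (suc j))

-- The combination has the shape of `mulXY`, so that division commutes with multiplication by m + 1
-- - x + y.
divX-linear : ∀ k c f g h →
  divX k (λ i j → c * f i j - g i j + h i j) ≐
  λ i j → c * divX k f i j - divX k g i j + divX k h i j
divX-linear k c f g h zero j =
  solve 5 (λ s c f g h → s :* (c :* f :- g :+ h) := c :* (s :* f) :- s :* g :+ s :* h) refl
    (recip k) c (f zero j) (g zero j) (h zero j)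
divX-linear k c f g h (suc i) j = trans
  (cong (λ z → recip k * (c * f (suc i) j - g (suc i) j + h (suc i) j + z)) (divX-linear k c f g h i j))
  (solve 8 (λ s c f g h f′ g′ h′ →
      s :* ((c :* f :- g :+ h) :+ (c :* f′ :- g′ :+ h′)) :=
      c :* (s :* (f :+ f′)) :- s :* (g :+ g′) :+ s :* (h :+ h′)) refl
    (recip k) c (f (suc i) j) (g (suc i) j) (h (suc i) j)
    (divX k f i j) (divX k g i j) (divX k h i j))

divX-minus : ∀ k f g → divX k (λ i j → f i j - g i j) ≐ λ i j → divX k f i j - divX k g i j
divX-minus k f g zero    j =
  solve 3 (λ s f g → s :* (f :- g) := s :* f :- s :* g) refl (recip k) (f zero j) (g zero j)
divX-minus k f g (suc i) j = trans
  (cong (λ z → recip k * (f (suc i) j - g (suc i) j + z)) (divX-minus k f g i j))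
  (solve 5 (λ s f g f′ g′ → s :* ((f :- g) :+ (f′ :- g′)) := s :* (f :+ f′) :- s :* (g :+ g′)) refl
    (recip k) (f (suc i) j) (g (suc i) j) (divX k f i j) (divX k g i j))

divX-scale : ∀ k c f → divX k (λ i j → c * f i j) ≐ λ i j → c * divX k f i j
divX-scale k c f zero    j =
  solve 3 (λ s c f → s :* (c :* f) := c :* (s :* f)) refl (recip k) c (f zero j)
divX-scale k c f (suc i) j = trans
  (cong (λ z → recip k * (c * f (suc i) j + z)) (divX-scale k c f i j))
  (solve 4 (λ s c f f′ → s :* (c :* f :+ c :* f′) := c :* (s :* (f :+ f′))) refl
    (recip k) c (f (suc i) j) (divX k f i j))

divY-minus : ∀ k f g → divY k (λ i j → f i j - g i j) ≐ λ i j → divY k f i j - divY k g i j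
divY-minus k f g i j = divX-minus k (flip f) (flip g) j i

divX-mulXY : ∀ k m f → divX k (mulXY m f) ≐ mulXY m (divX k f)
divX-mulXY k m f i j = trans (divX-linear k (ι (suc m)) f (X f) (Y f) i j)
  (cong₂ (λ u v → ι (suc m) * divX k f i j - u + v) (divX-X k f i j) (divX-Y k f i j))

-- Dividing (l + 1 - x) g by k + 1 - x, where g = f / (l + 1 - x)
divX-quotient : ∀ k l f i j →
  divX k f i j ≡ ι (suc l) * divX k (divX l f) i j - X (divX k (divX l f)) i j
divX-quotient k l f i j = begin
  divX k f i j
    ≡⟨ divX-cong k (λ i j → sym (divX-inverse l f i j)) i j ⟩
  divX k (λ i j → ι (suc l) * g i j - X g i j) i j
    ≡⟨ divX-minus k (λ i j → ι (suc l) * g i j) (X g) i j ⟩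
  divX k (λ i j → ι (suc l) * g i j) i j - divX k (X g) i j
    ≡⟨ cong₂ _-_ (divX-scale k (ι (suc l)) g i j) (divX-X k g i j) ⟩
  ι (suc l) * divX k g i j - X (divX k g) i j ∎
  where
  open ≡-Reasoning
  g = divX l f

divX-comm : ∀ k l f → divX k (divX l f) ≐ divX l (divX k f)
divX-comm k l f =
  divX-unique l (divX k f) (divX k (divX l f)) (λ i j → sym (divX-quotient k l f i j))

-- Partial fractions and shifted products

ι-+ : ∀ m n → ι (m ℕ.+ n) ≡ ι m + ι n
ι-+ zero    n = sym (+-identityˡ (ι n))
ι-+ (suc m) n = begin
  ι (suc (m ℕ.+ n))  ≡⟨ ι-suc (m ℕ.+ n) ⟩
  ι (m ℕ.+ n) + 1ℚ   ≡⟨ cong (_+ 1ℚ) (ι-+ m n) ⟩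
  ι m + ι n + 1ℚ     ≡⟨ solve 2 (λ m n → m :+ n :+ con 1ℚ := m :+ con 1ℚ :+ n) refl (ι m) (ι n) ⟩
  ι m + 1ℚ + ι n     ≡⟨ cong (_+ ι n) (sym (ι-suc m)) ⟩
  ι (suc m) + ι n    ∎
  where open ≡-Reasoning

ι-split : ∀ q m → ι (suc (suc q ℕ.+ m)) ≡ ι (suc q) + ι (suc m)
ι-split q m = trans (cong ι (sym (ℕₚ.+-suc (suc q) m))) (ι-+ (suc q) (suc m))

-- Partial fractions: the denominators q + 1 - x and q + m + 2 - x differ by m + 1, which `recip m`
-- cancels.
resolvent : ∀ q m f i j →
  recip m * (divX q f i j - divX (suc q ℕ.+ m) f i j) ≡ divX q (divX (suc q ℕ.+ m) f) i j
resolvent q m f i j = begin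
  s * (divX q f i j - divX p f i j)
    ≡⟨ cong (s *_) (cong₂ _-_ (divX-quotient q p f i j) (sym (divX-inverse q (divX p f) i j))) ⟩
  s * ((ι (suc p) * g - x) - (b * g - x))
    ≡⟨ cong (λ z → s * ((z * g - x) - (b * g - x))) (ι-split q m) ⟩
  s * (((b + a) * g - x) - (b * g - x))
    ≡⟨ solve 5 (λ s a b g x → s :* (((b :+ a) :* g :- x) :- (b :* g :- x)) := s :* a :* g) refl s a b g x ⟩
  s * a * g
    ≡⟨ cong (_* g) (recip-inverse m) ⟩
  1ℚ * g
    ≡⟨ *-identityˡ g ⟩
  g ∎
  where
  open ≡-Reasoning
  p = suc q ℕ.+ m
  s = recip m
  a = ι (suc m)
  b = ι (suc q)
  g = divX q (divX p f) i j
  x = X (divX q (divX p f)) i j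

-- ∏_{1≤j≤m} (j - x + y) / (j + q - x)
ratio : ℕ → ℕ → Series
ratio q zero    = one
ratio q (suc m) = divX (q ℕ.+ m) (mulXY m (ratio q m))

-- Both sides are ∏ (j - x + y) over 1 ≤ j ≤ m divided by ∏ (j + q - x) over 1 ≤ j ≤ m + 1. The left
-- splits off the last denominator, the right the first.
ratio-shift : ∀ q m → divX (q ℕ.+ m) (ratio q m) ≐ divX q (ratio (suc q) m)
ratio-shift q zero i j = cong (λ k → divX k one i j) (ℕₚ.+-identityʳ q)
ratio-shift q (suc m) i j = begin
  divX (q ℕ.+ suc m) (divX (q ℕ.+ m) (mulXY m (ratio q m))) i j
    ≡⟨ cong (λ k → divX k (divX (q ℕ.+ m) (mulXY m (ratio q m))) i j) (ℕₚ.+-suc q m) ⟩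
  divX p (divX (q ℕ.+ m) (mulXY m (ratio q m))) i j
    ≡⟨ divX-cong p (divX-mulXY (q ℕ.+ m) m (ratio q m)) i j ⟩
  divX p (mulXY m (divX (q ℕ.+ m) (ratio q m))) i j
    ≡⟨ divX-cong p (mulXY-cong m (ratio-shift q m)) i j ⟩
  divX p (mulXY m (divX q (ratio (suc q) m))) i j
    ≡⟨ divX-cong p (λ i j → sym (divX-mulXY q m (ratio (suc q) m) i j)) i j ⟩
  divX p (divX q (mulXY m (ratio (suc q) m))) i j
    ≡⟨ divX-comm p q (mulXY m (ratio (suc q) m)) i j ⟩
  divX q (divX p (mulXY m (ratio (suc q) m))) i j ∎
  where
  open ≡-Reasoning
  p = suc q ℕ.+ m

-- Connected sums and their telescoping

connectedSum : ℕ → ℕ → Series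
connectedSum q M i j = sumBelow (λ m → recip m * divX (q ℕ.+ m) (ratio q m) i j) M

-- The antidifference in m: R_q - R_{q+1}, cut at M, is `corner q 0` minus `corner q M`.
corner : ℕ → ℕ → Series
corner q m = divY q (divX q (ratio (suc q) m))

-- (q + m + 2 - x) - (m + 1 - x + y) = q + 1 - y
corner-step : ∀ q m → divX q (divX (suc q ℕ.+ m) (ratio (suc q) m)) ≐
                      λ i j → corner q m i j - corner q (suc m) i j
corner-step q m i j = trans
  (divY-unique q (λ i j → divX q v i j - divX q (divX p (mulXY m v)) i j) (divX q (divX p v)) cleared i j)
  (divY-minus q (divX q v) (divX q (divX p (mulXY m v))) i j)
  where
  open ≡-Reasoning
  p = suc q ℕ.+ m
  v = ratio (suc q) m
  g = divX q (divX p v)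

  cleared : ∀ i j → ι (suc q) * g i j - Y g i j ≡ divX q v i j - divX q (divX p (mulXY m v)) i j
  cleared i j = sym (begin
    divX q v i j - divX q (divX p (mulXY m v)) i j
      -- Both quotients are brought over the common denominator (q + 1 - x)(q + m + 2 - x), that is,
      -- written as multiples of g.
      ≡⟨ cong₂ _-_ (divX-quotient q p v i j) (trans
           (divX-cong q (divX-mulXY p m v) i j) (divX-mulXY q m (divX p v) i j)) ⟩
    (ι (suc p) * g i j - X g i j) - (ι (suc m) * g i j - X g i j + Y g i j)
      ≡⟨ cong (λ z → (z * g i j - X g i j) - (ι (suc m) * g i j - X g i j + Y g i j)) (ι-split q m) ⟩
    ((ι (suc q) + ι (suc m)) * g i j - X g i j) - (ι (suc m) * g i j - X g i j + Y g i j)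
      ≡⟨ solve 5 (λ a b g x y → ((a :+ b) :* g :- x) :- (b :* g :- x :+ y) := a :* g :- y) refl
           (ι (suc q)) (ι (suc m)) (g i j) (X g i j) (Y g i j) ⟩
    ι (suc q) * g i j - Y g i j ∎)

-- Induction on M. `ratio-shift` rewrites the new term of R_q with the same product v as that of
-- R_{q+1}; by `resolvent` the two terms then differ by v / ((q + 1 - x)(q + M + 2 - x)), which
-- `corner-step` turns into a difference of consecutive corners.
connectedSum-step : ∀ q M → connectedSum q M ≐
  λ i j → connectedSum (suc q) M i j + (corner q 0 i j - corner q M i j)
connectedSum-step q zero    i j = sym (trans (+-identityˡ _) (+-inverseʳ (corner q 0 i j)))
connectedSum-step q (suc M) i j = begin
  connectedSum q M i j + recip M * divX (q ℕ.+ M) (ratio q M) i j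
    ≡⟨ cong₂ _+_ (connectedSum-step q M i j) term ⟩
  (r + (c₀ - c)) + (recip M * d′ + (c - c′))
    ≡⟨ solve 5 (λ r c₀ c d c′ → (r :+ (c₀ :- c)) :+ (d :+ (c :- c′)) := (r :+ d) :+ (c₀ :- c′))
         refl r c₀ c (recip M * d′) c′ ⟩
  (r + recip M * d′) + (c₀ - c′) ∎
  where
  open ≡-Reasoning
  v  = ratio (suc q) M
  r  = connectedSum (suc q) M i j
  c₀ = corner q 0 i j
  c  = corner q M i j
  c′ = corner q (suc M) i j
  d  = divX q v i j
  d′ = divX (suc q ℕ.+ M) v i j

  term : recip M * divX (q ℕ.+ M) (ratio q M) i j ≡ recip M * d′ + (c - c′)
  term = begin
    recip M * divX (q ℕ.+ M) (ratio q M) i j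
      ≡⟨ cong (recip M *_) (ratio-shift q M i j) ⟩
    recip M * d
      ≡⟨ solve 3 (λ s d d′ → s :* d := s :* d′ :+ s :* (d :- d′)) refl (recip M) d d′ ⟩
    recip M * d′ + recip M * (d - d′)
      ≡⟨ cong (recip M * d′ +_) (trans (resolvent q M v i j) (corner-step q M i j)) ⟩
    recip M * d′ + (c - c′) ∎

connectedSum-transport : ∀ K M i j → connectedSum 0 M i j ≡
  connectedSum K M i j + (sumBelow (λ q → corner q 0 i j) K - sumBelow (λ q → corner q M i j) K)
connectedSum-transport zero    M i j = sym (+-identityʳ _)
connectedSum-transport (suc K) M i j = begin
  connectedSum 0 M i j
    ≡⟨ connectedSum-transport K M i j ⟩
  connectedSum K M i j + (a - b)
    ≡⟨ cong (_+ (a - b)) (connectedSum-step K M i j) ⟩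
  (r + (c₀ - c)) + (a - b)
    ≡⟨ solve 5 (λ r c₀ c a b → (r :+ (c₀ :- c)) :+ (a :- b) := r :+ ((a :+ c₀) :- (b :+ c)))
         refl r c₀ c a b ⟩
  r + ((a + c₀) - (b + c)) ∎
  where
  open ≡-Reasoning
  r  = connectedSum (suc K) M i j
  a  = sumBelow (λ q → corner q 0 i j) K
  b  = sumBelow (λ q → corner q M i j) K
  c₀ = corner K 0 i j
  c  = corner K M i j

-- The zeta series as boundary terms

-- Stated for arbitrary nonzero factors, which can be matched as successors, because `suc i ^ k`
-- does not compute to one.
recip-mult : ∀ a b .{{_ : ℕ.NonZero a}} .{{_ : ℕ.NonZero b}} .{{_ : ℕ.NonZero (a ℕ.* b)}} →
             ℤ.+ 1 / (a ℕ.* b) ≡ (ℤ.+ 1 / a) * (ℤ.+ 1 / b)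
recip-mult (suc a) (suc b) = sym (recip-* a b)

recipPow-suc : ∀ i k → recipPow i (suc k) ≡ recip i * recipPow i k
recipPow-suc i k = recip-mult (suc i) (suc i ℕ.^ k)
  {{_}} {{ℕₚ.m^n≢0 (suc i) k}} {{ℕₚ.m^n≢0 (suc i) (suc k)}}

recipPow-1 : ∀ i → recipPow i 1 ≡ recip i
recipPow-1 i = trans (recipPow-suc i 0) (*-identityʳ (recip i))

-- The geometric series of 1 / (q + 1 - x); the factor `one 0 j` confines it to y^0.
divX-one : ∀ q i j → divX q one i j ≡ recipPow q (suc i) * one 0 j
divX-one q zero j = cong (_* one 0 j) (sym (recipPow-1 q))
divX-one q (suc i) j = begin
  recip q * (0ℚ + divX q one i j)        ≡⟨ cong (recip q *_) (+-identityˡ _) ⟩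
  recip q * divX q one i j               ≡⟨ cong (recip q *_) (divX-one q i j) ⟩
  recip q * (recipPow q (suc i) * one 0 j)   ≡⟨ sym (*-assoc (recip q) _ _) ⟩
  recip q * recipPow q (suc i) * one 0 j     ≡⟨ cong (_* one 0 j) (sym (recipPow-suc q (suc i))) ⟩
  recipPow q (suc (suc i)) * one 0 j         ∎
  where open ≡-Reasoning

-- The product of the geometric series in x and in y. Its coefficients depend on i + j only, which
-- is why the final value depends on the weight and not on the depth.
corner-0 : ∀ q i j → corner q 0 i j ≡ recipPow q (2 ℕ.+ (j ℕ.+ i))
corner-0 q i zero = begin
  recip q * divX q one i zero           ≡⟨ cong (recip q *_) (divX-one q i zero) ⟩
  recip q * (recipPow q (suc i) * 1ℚ)   ≡⟨ cong (recip q *_) (*-identityʳ _) ⟩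
  recip q * recipPow q (suc i)          ≡⟨ sym (recipPow-suc q (suc i)) ⟩
  recipPow q (2 ℕ.+ i)                  ∎
  where open ≡-Reasoning
corner-0 q i (suc j) = begin
  recip q * (divX q one i (suc j) + corner q 0 i j)
    ≡⟨ cong₂ (λ u v → recip q * (u + v)) (trans (divX-one q i (suc j)) (*-zeroʳ (recipPow q (suc i)))) (corner-0 q i j) ⟩
  recip q * (0ℚ + recipPow q (2 ℕ.+ (j ℕ.+ i)))
    ≡⟨ cong (recip q *_) (+-identityˡ _) ⟩
  recip q * recipPow q (2 ℕ.+ (j ℕ.+ i))
    ≡⟨ sym (recipPow-suc q (2 ℕ.+ (j ℕ.+ i))) ⟩
  recipPow q (2 ℕ.+ (suc j ℕ.+ i)) ∎
  where open ≡-Reasoning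

-- Truncated multiple zeta values as coefficients

truncatedSum : ∀ {r} → List (Vec ℕ r) → ℕ → ℚ
truncatedSum vs N = sumOver (λ v → truncated v N) vs

truncatedSum-prepend : ∀ {r} ks (rest : ℕ → List (Vec ℕ r)) n N →
  truncatedSum (prepend ks rest n) N ≡
  sumBelow (λ i → sumOver (λ k → recipPow i k * truncatedSum (rest (n ℕ.∸ k)) i) ks) N
truncatedSum-prepend ks rest n N = begin
  truncatedSum (prepend ks rest n) N
    ≡⟨ sumOver-concatMap (λ v → truncated v N) (λ k → map (k ∷_) (rest (n ℕ.∸ k))) ks ⟩
  sumOver (λ k → truncatedSum (map (k ∷_) (rest (n ℕ.∸ k))) N) ks
    ≡⟨ sumOver-cong first ks ⟩
  sumOver (λ k → sumBelow (λ i → recipPow i k * truncatedSum (rest (n ℕ.∸ k)) i) N) ks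
    ≡⟨ sumOver-sumBelow (λ k i → recipPow i k * truncatedSum (rest (n ℕ.∸ k)) i) N ks ⟩
  sumBelow (λ i → sumOver (λ k → recipPow i k * truncatedSum (rest (n ℕ.∸ k)) i) ks) N ∎
  where
  open ≡-Reasoning
  first : ∀ k → truncatedSum (map (k ∷_) (rest (n ℕ.∸ k))) N ≡
                sumBelow (λ i → recipPow i k * truncatedSum (rest (n ℕ.∸ k)) i) N
  first k = begin
    truncatedSum (map (k ∷_) vs) N
      ≡⟨ sumOver-map (λ v → truncated v N) (k ∷_) vs ⟩
    sumOver (λ v → truncated (k ∷ v) N) vs
      ≡⟨ sumOver-sumBelow (λ v i → recipPow i k * truncated v i) N vs ⟩
    sumBelow (λ i → sumOver (λ v → recipPow i k * truncated v i) vs) N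
      ≡⟨ sumBelow-cong (λ i → sumOver-*ˡ (recipPow i k) (λ v → truncated v i) vs) N ⟩
    sumBelow (λ i → recipPow i k * truncatedSum vs i) N ∎
    where vs = rest (n ℕ.∸ k)

compositionSum : ℕ → ℕ → ℕ → ℚ
compositionSum r n = truncatedSum (compositions r n)

-- The contribution of n₁ = i + 1 to compositionSum (suc r) n
innerSum : ℕ → ℕ → ℕ → ℚ
innerSum r n i = sumOver (λ c → recipPow i (suc c) * compositionSum r (n ℕ.∸ suc c) i) (upTo n)

compositionSum-suc : ∀ r n N → compositionSum (suc r) n N ≡ sumBelow (innerSum r n) N
compositionSum-suc r n N = trans
  (truncatedSum-prepend (map (1 ℕ.+_) (upTo n)) (compositions r) n N)
  (sumBelow-cong (λ i → sumOver-map _ suc (upTo n)) N)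

pull-recip : ∀ i k c → recipPow i (suc k) * c ≡ recip i * (recipPow i k * c)
pull-recip i k c = trans (cong (_* c) (recipPow-suc i k)) (*-assoc (recip i) (recipPow i k) c)

-- The choice k₁ = 1 leaves weight n to the other entries; if k₁ ≥ 2, lowering k₁ by one takes out a
-- factor 1 / (i + 1). This is the recurrence of division by i + 1 - x.
innerSum-suc : ∀ r n i → innerSum r (suc n) i ≡ recip i * (compositionSum r n i + innerSum r n i)
innerSum-suc r n i = begin
  recipPow i 1 * A + sumOver F (applyUpTo suc n)
    ≡⟨ cong (λ z → recipPow i 1 * A + sumOver F z) (sym (map-upTo suc n)) ⟩
  recipPow i 1 * A + sumOver F (map suc (upTo n))
    ≡⟨ cong₂ (λ u v → u * A + v) (recipPow-1 i) (sumOver-map F suc (upTo n)) ⟩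
  recip i * A + sumOver (F ∘ suc) (upTo n)
    ≡⟨ cong (recip i * A +_) (sumOver-cong (λ c → pull-recip i (suc c) _) (upTo n)) ⟩
  recip i * A + sumOver (λ c → recip i * G c) (upTo n)
    ≡⟨ cong (recip i * A +_) (sumOver-*ˡ (recip i) G (upTo n)) ⟩
  recip i * A + recip i * innerSum r n i
    ≡⟨ sym (*-distribˡ-+ (recip i) A (innerSum r n i)) ⟩
  recip i * (A + innerSum r n i) ∎
  where
  open ≡-Reasoning
  A = compositionSum r n i
  F G : ℕ → ℚ
  F c = recipPow i (suc c) * compositionSum r (suc n ℕ.∸ suc c) i
  G c = recipPow i (suc c) * compositionSum r (n ℕ.∸ suc c) i

mutual
  compositionSum-< : ∀ r n N → n < r → compositionSum r n N ≡ 0ℚ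
  compositionSum-< (suc r) n N (s≤s n≤r) =
    trans (compositionSum-suc r n N) (sumBelow-0 (λ i → innerSum-≤ r n i n≤r) N)

  -- Too little weight is left for r further entries. The case n = r starts the recurrence in
  -- `innerSum-divX`.
  innerSum-≤ : ∀ r n i → n ≤ r → innerSum r n i ≡ 0ℚ
  innerSum-≤ r zero    i n≤r = refl
  innerSum-≤ r (suc n) i n<r = begin
    innerSum r (suc n) i
      ≡⟨ innerSum-suc r n i ⟩
    recip i * (compositionSum r n i + innerSum r n i)
      ≡⟨ cong₂ (λ u v → recip i * (u + v)) (compositionSum-< r n i n<r)
           (innerSum-≤ r n i (ℕₚ.<⇒≤ n<r)) ⟩
    recip i * (0ℚ + 0ℚ)
      ≡⟨ *-zeroʳ (recip i) ⟩
    0ℚ ∎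
    where open ≡-Reasoning

-- The exponent of x is the excess of the weight over the depth.
compositionSeries : ℕ → Series
compositionSeries N i j = compositionSum j (j ℕ.+ i) N

-- An entry k at n₁ = N + 1 contributes x^(k-1) y / (N + 1)^k, and the sum of these over k ≥ 1 is y
-- / (N + 1 - x). The factor y is absorbed in the shift from depth j + 1 to j.
innerSum-divX : ∀ N i j → innerSum j (suc (j ℕ.+ i)) N ≡ divX N (compositionSeries N) i j
innerSum-divX N zero j = trans (innerSum-suc j (j ℕ.+ 0) N) (cong (recip N *_)
  (trans (cong (compositionSum j (j ℕ.+ 0) N +_)
           (innerSum-≤ j (j ℕ.+ 0) N (ℕₚ.≤-reflexive (ℕₚ.+-identityʳ j))))
         (+-identityʳ _)))
innerSum-divX N (suc i) j = trans (innerSum-suc j (j ℕ.+ suc i) N)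
  (cong (λ z → recip N * (compositionSum j (j ℕ.+ suc i) N + z))
    (trans (cong (λ z → innerSum j z N) (ℕₚ.+-suc j i)) (innerSum-divX N i j)))

-- The new factor (N + 1 - x + y) / (N + 1 - x) is 1 + y / (N + 1 - x).
ratio-0-suc : ∀ N → ratio 0 (suc N) ≐ λ i j → ratio 0 N i j + Y (divX N (ratio 0 N)) i j
ratio-0-suc N i j = trans (divX-mulXY N N (ratio 0 N) i j)
  (cong (_+ Y (divX N (ratio 0 N)) i j) (divX-inverse N (ratio 0 N) i j))

-- Each integer n ≤ N is either absent from n₁ > n₂ > ... or occurs once with some exponent, which
-- gives the factor 1 + y / (n - x). The induction separates the terms with n₁ = N + 1.
compositionSeries≐ratio : ∀ N → compositionSeries N ≐ ratio 0 N
compositionSeries≐ratio zero    zero    zero    = refl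
compositionSeries≐ratio zero    (suc i) zero    = refl
compositionSeries≐ratio zero    zero    (suc j) = compositionSum-suc j (suc j ℕ.+ 0) 0
compositionSeries≐ratio zero    (suc i) (suc j) = compositionSum-suc j (suc j ℕ.+ suc i) 0
compositionSeries≐ratio (suc N) i zero = begin
  compositionSeries (suc N) i 0  ≡⟨ constant i ⟩
  compositionSeries N i 0        ≡⟨ compositionSeries≐ratio N i 0 ⟩
  ratio 0 N i 0                  ≡⟨ sym (+-identityʳ _) ⟩
  ratio 0 N i 0 + 0ℚ             ≡⟨ sym (ratio-0-suc N i 0) ⟩
  ratio 0 (suc N) i 0            ∎
  where
  open ≡-Reasoning
  constant : ∀ i → compositionSeries (suc N) i 0 ≡ compositionSeries N i 0
  constant zero    = refl
  constant (suc i) = refl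
compositionSeries≐ratio (suc N) i (suc j) = begin
  compositionSum (suc j) (suc (j ℕ.+ i)) (suc N)
    ≡⟨ compositionSum-suc j (suc (j ℕ.+ i)) (suc N) ⟩
  sumBelow (innerSum j (suc (j ℕ.+ i))) N + innerSum j (suc (j ℕ.+ i)) N
    ≡⟨ cong₂ _+_ (sym (compositionSum-suc j (suc (j ℕ.+ i)) N)) (innerSum-divX N i j) ⟩
  compositionSeries N i (suc j) + divX N (compositionSeries N) i j
    ≡⟨ cong₂ _+_ (compositionSeries≐ratio N i (suc j))
         (divX-cong N (compositionSeries≐ratio N) i j) ⟩
  ratio 0 N i (suc j) + divX N (ratio 0 N) i j
    ≡⟨ sym (ratio-0-suc N i (suc j)) ⟩
  ratio 0 (suc N) i (suc j) ∎
  where open ≡-Reasoning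

-- Admissibility changes only the outermost factor: the sum of x^(k-2) / n₁^k over k ≥ 2 is 1 / (n₁
-- (n₁ - x)). Hence the exponent of x is the weight minus the depth minus 1.
truncatedSum-indices : ∀ i j N →
  truncatedSum (indices (2 ℕ.+ (j ℕ.+ i)) (suc j)) N ≡ connectedSum 0 N i j
truncatedSum-indices i j N = trans
  (truncatedSum-prepend (map (2 ℕ.+_) (upTo n)) (compositions j) (suc n) N)
  (sumBelow-cong term N)
  where
  open ≡-Reasoning
  n = suc (j ℕ.+ i)
  term : ∀ m → sumOver (λ k → recipPow m k * compositionSum j (suc n ℕ.∸ k) m) (map (2 ℕ.+_) (upTo n)) ≡
               recip m * divX m (ratio 0 m) i j
  term m = begin
    sumOver (λ k → recipPow m k * compositionSum j (suc n ℕ.∸ k) m) (map (2 ℕ.+_) (upTo n))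
      ≡⟨ sumOver-map (λ k → recipPow m k * compositionSum j (suc n ℕ.∸ k) m) (2 ℕ.+_) (upTo n) ⟩
    sumOver (λ c → recipPow m (2 ℕ.+ c) * compositionSum j (n ℕ.∸ suc c) m) (upTo n)
      ≡⟨ sumOver-cong (λ c → pull-recip m (suc c) _) (upTo n) ⟩
    sumOver (λ c → recip m * (recipPow m (suc c) * compositionSum j (n ℕ.∸ suc c) m)) (upTo n)
      ≡⟨ sumOver-*ˡ (recip m) _ (upTo n) ⟩
    recip m * innerSum j n m
      ≡⟨ cong (recip m *_) (trans (innerSum-divX m i j) (divX-cong m (compositionSeries≐ratio m) i j)) ⟩
    recip m * divX m (ratio 0 m) i j ∎

seq-S : ∀ n r N → seq (S n r) N ≡ truncatedSum (indices n r) N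
seq-S n r N = go (indices-admissible n r)
  where
  go : ∀ {vs} (adms : All Admissible vs) →
       seq (sumℝ (All.reduce (λ {ks} adm → mzv ks adm) adms)) N ≡ truncatedSum vs N
  go []                = refl
  go (_∷_ {v} _ adms) = cong (truncated v N +_) (go adms)

-- Bounds

-- The radius is 1/6 because three such terms, two from m + 1 - x + y and one from the division,
-- make up the ½ in the definition of `P`.
sixth : ℚ
sixth = ℤ.+ 1 / 6

6ℚ : ℚ
6ℚ = ℤ.+ 6 / 1

0≤sixth : 0ℚ ℚ.≤ sixth
0≤sixth = nonNegative⁻¹ sixth

6^ : ℕ → ℚ
6^ zero    = 1ℚ
6^ (suc n) = 6ℚ * 6^ n

0<6^ : ∀ n → 0ℚ ℚ.< 6^ n
0<6^ zero    = positive⁻¹ 1ℚ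
0<6^ (suc n) = 0<* (positive⁻¹ 6ℚ) (0<6^ n)

0≤6^ : ∀ n → 0ℚ ℚ.≤ 6^ n
0≤6^ n = <⇒≤ (0<6^ n)

-- Sup norm of the coefficients at ∣x∣ = ∣y∣ = 1/6; multiplication by j - x + y
-- has norm at most j + 2/6, division by k - x at most 1 / (k - 1/6).
record Bounded (f : Series) (b : ℚ) : Set where
  constructor bounded
  field
    bound : ∀ i j → ∣ f i j ∣ ℚ.≤ b * 6^ (i ℕ.+ j)

open Bounded

Bounded-flip : ∀ {f b} → Bounded f b → Bounded (flip f) b
Bounded-flip {f} {b} hf = bounded λ i j →
  subst (λ n → ∣ f j i ∣ ℚ.≤ b * 6^ n) (ℕₚ.+-comm j i) (bound hf j i)

Bounded-X : ∀ {f b} → 0ℚ ℚ.≤ b → Bounded f b → Bounded (X f) (sixth * b)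
Bounded-X {f} {b} 0≤b hf = bounded λ where
  zero    j → 0≤* (0≤* 0≤sixth 0≤b) (0≤6^ j)
  (suc i) j → ≤-trans (bound hf i j) (≤-reflexive
    (solve 2 (λ b w → b :* w := con sixth :* b :* (con 6ℚ :* w)) refl b (6^ (i ℕ.+ j))))

Bounded-Y : ∀ {f b} → 0ℚ ℚ.≤ b → Bounded f b → Bounded (Y f) (sixth * b)
Bounded-Y 0≤b hf = Bounded-flip (Bounded-X 0≤b (Bounded-flip hf))

∣*∣≤ : ∀ {a p q} → 0ℚ ℚ.≤ a → ∣ p ∣ ℚ.≤ q → ∣ a * p ∣ ℚ.≤ a * q
∣*∣≤ {a} {p} {q} 0≤a h = begin
  ∣ a * p ∣      ≡⟨ ∣p*q∣≡∣p∣*∣q∣ a p ⟩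
  ∣ a ∣ * ∣ p ∣  ≡⟨ cong (_* ∣ p ∣) (0≤p⇒∣p∣≡p 0≤a) ⟩
  a * ∣ p ∣      ≤⟨ *-monoˡ 0≤a h ⟩
  a * q          ∎
  where open ≤-Reasoning

∣+∣≤ : ∀ {p q a b} → ∣ p ∣ ℚ.≤ a → ∣ q ∣ ℚ.≤ b → ∣ p + q ∣ ℚ.≤ a + b
∣+∣≤ {p} {q} hp hq = ≤-trans (∣p+q∣≤∣p∣+∣q∣ p q) (+-mono-≤ hp hq)

∣-∣≤ : ∀ {p q a b} → ∣ p ∣ ℚ.≤ a → ∣ q ∣ ℚ.≤ b → ∣ p - q ∣ ℚ.≤ a + b
∣-∣≤ {p} {q} hp hq = ∣+∣≤ {p} { - q} hp (≤-trans (≤-reflexive (∣-p∣≡∣p∣ q)) hq)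

Bounded-mulXY : ∀ m {f b} → 0ℚ ℚ.≤ b → Bounded f b →
                Bounded (mulXY m f) ((ι (suc m) + (sixth + sixth)) * b)
Bounded-mulXY m {f} {b} 0≤b hf = bounded λ i j → let w = 6^ (i ℕ.+ j) in begin
  ∣ mulXY m f i j ∣
    ≤⟨ ∣+∣≤ {a * f i j - X f i j} {Y f i j}
         (∣-∣≤ {a * f i j} {X f i j} (∣*∣≤ {a} {f i j} (0≤ι (suc m)) (bound hf i j))
           (bound (Bounded-X 0≤b hf) i j))
         (bound (Bounded-Y 0≤b hf) i j) ⟩
  a * (b * w) + sixth * b * w + sixth * b * w
    ≡⟨ solve 4 (λ a b w s → a :* (b :* w) :+ s :* b :* w :+ s :* b :* w := (a :+ (s :+ s)) :* b :* w)
         refl a b w sixth ⟩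
  (a + (sixth + sixth)) * b * w ∎
  where
  open ≤-Reasoning
  a = ι (suc m)

-- The hypothesis is c ≥ b / (k + 1 - 1/6) without the division. It closes the induction on i, where
-- the preceding coefficient of the quotient enters with norm c/6.
Bounded-divX : ∀ k {f b c} → 0ℚ ℚ.≤ c → b + sixth * c ℚ.≤ ι (suc k) * c →
               Bounded f b → Bounded (divX k f) c
Bounded-divX k {f} {b} {c} 0≤c h hf = bounded go
  where
  open ≤-Reasoning
  s = recip k

  scaled : ∀ {z w} → 0ℚ ℚ.≤ w → ∣ z ∣ ℚ.≤ (b + sixth * c) * w → ∣ s * z ∣ ℚ.≤ c * w
  scaled {z} {w} 0≤w hz = begin
    ∣ s * z ∣                    ≤⟨ ∣*∣≤ {s} {z} (0≤recip k) hz ⟩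
    s * ((b + sixth * c) * w)    ≤⟨ *-monoˡ (0≤recip k) (*-monoʳ 0≤w h) ⟩
    s * (ι (suc k) * c * w)      ≡⟨ solve 4 (λ s a c w → s :* (a :* c :* w) := s :* a :* (c :* w)) refl s (ι (suc k)) c w ⟩
    s * ι (suc k) * (c * w)      ≡⟨ cong (_* (c * w)) (recip-inverse k) ⟩
    1ℚ * (c * w)                 ≡⟨ *-identityˡ (c * w) ⟩
    c * w                        ∎

  go : ∀ i j → ∣ divX k f i j ∣ ℚ.≤ c * 6^ (i ℕ.+ j)
  go zero    j = scaled {f 0 j} (0≤6^ j)
    (≤-trans (bound hf 0 j) (*-monoʳ {6^ j} {b} {b + sixth * c} (0≤6^ j) (p≤p+q (0≤* 0≤sixth 0≤c))))
  go (suc i) j = scaled {f (suc i) j + divX k f i j} (0≤6^ (suc i ℕ.+ j)) (begin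
    ∣ f (suc i) j + divX k f i j ∣
      ≤⟨ ∣+∣≤ {f (suc i) j} {divX k f i j} (bound hf (suc i) j) (go i j) ⟩
    b * (6ℚ * w) + c * w
      ≡⟨ solve 3 (λ b c w → b :* (con 6ℚ :* w) :+ c :* w := (b :+ con sixth :* c) :* (con 6ℚ :* w))
           refl b c w ⟩
    (b + sixth * c) * (6ℚ * w) ∎)
    where w = 6^ (i ℕ.+ j)

-- Since k + 1 - 1/6 is at least half of k + 1, a factor 2 suffices and the bound stays a multiple
-- of `recip k`.
Bounded-divX-double : ∀ k {f b} → 0ℚ ℚ.≤ b → Bounded f b → Bounded (divX k f) (2ℚ * (recip k * b))
Bounded-divX-double k {f} {b} 0≤b = Bounded-divX k (0≤* 0≤2 (0≤* (0≤recip k) 0≤b)) (begin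
  b + sixth * (2ℚ * (recip k * b))
    ≤⟨ +-monoʳ-≤ b (*-monoˡ 0≤sixth (*-monoˡ 0≤2 (*-monoʳ 0≤b (recip≤1 k)))) ⟩
  b + sixth * (2ℚ * (1ℚ * b))
    -- The slack between b + 2b/6 and 2b is 4b/6.
    ≤⟨ p≤p+q (0≤* (0≤* 0≤4 0≤sixth) 0≤b) ⟩
  b + sixth * (2ℚ * (1ℚ * b)) + 4ℚ * sixth * b
    ≡⟨ solve 1 (λ b → b :+ con sixth :* (con 2ℚ :* (con 1ℚ :* b)) :+ con 4ℚ :* con sixth :* b :=
                      con 2ℚ :* (con 1ℚ :* b)) refl b ⟩
  2ℚ * (1ℚ * b)
    ≡⟨ cong (λ z → 2ℚ * (z * b)) (sym (recip-inverse k)) ⟩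
  2ℚ * (recip k * ι (suc k) * b)
    ≡⟨ solve 3 (λ s a b → con 2ℚ :* (s :* a :* b) := a :* (con 2ℚ :* (s :* b))) refl
         (recip k) (ι (suc k)) b ⟩
  ι (suc k) * (2ℚ * (recip k * b)) ∎)
  where open ≤-Reasoning

tail-decreasing : ∀ m → tail (suc m) ℚ.≤ tail m
tail-decreasing m = *-cancelˡ-≤-pos 4ℚ (begin
  4ℚ * tail (suc m)                                ≡⟨ sym (+-identityˡ _) ⟩
  0ℚ + 4ℚ * tail (suc m)                           ≤⟨ +-monoˡ-≤ _ (0≤* (0≤* (0≤recip m) (0≤recip m)) (0≤P m)) ⟩
  recip m * recip m * P m + 4ℚ * tail (suc m)      ≤⟨ tail-step m ⟩
  4ℚ * tail m                                      ∎)
  where open ≤-Reasoning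

tail-antitone : ∀ {m n} → m ≤ n → tail n ℚ.≤ tail m
tail-antitone m≤n = go (ℕₚ.≤⇒≤′ m≤n)
  where
  go : ∀ {m n} → m ℕ.≤′ n → tail n ℚ.≤ tail m
  go (ℕ.≤′-reflexive refl)  = ≤-refl
  go (ℕ.≤′-step {n = n} h) = ≤-trans (tail-decreasing n) (go h)

-- The bound tail m is propagated exactly by the factor
-- (m + 1 + 2/6) / (m + 2 - 1/6) ≤ (m + 3/2) / (m + 2).
Bounded-ratio : ∀ q m → Bounded (ratio (suc q) m) (tail m)
Bounded-ratio q zero = bounded λ where
  zero    zero    → ≤-refl
  zero    (suc j) → 0≤* (0≤tail 0) (0≤6^ (suc j))
  (suc i) j       → 0≤* (0≤tail 0) (0≤6^ (suc i ℕ.+ j))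
Bounded-ratio q (suc m) = Bounded-divX (suc q ℕ.+ m) (0≤tail (suc m)) (begin
  (n + (sixth + sixth)) * (p * s) + sixth * tail (suc m)
    ≤⟨ +-monoʳ-≤ ((n + (sixth + sixth)) * (p * s)) (*-monoˡ 0≤sixth (tail-decreasing m)) ⟩
  (n + (sixth + sixth)) * (p * s) + sixth * (p * s)
    ≡⟨ solve 3 (λ n p s → (n :+ (con sixth :+ con sixth)) :* (p :* s) :+ con sixth :* (p :* s) :=
                          p :* (s :* n :+ con ½ :* s)) refl n p s ⟩
  p * (s * n + ½ * s)
    ≡⟨ cong (λ z → p * (z + ½ * s)) (recip-inverse m) ⟩
  P (suc m)
    ≡⟨ sym (*-identityʳ (P (suc m))) ⟩
  P (suc m) * 1ℚ
    ≡⟨ cong (P (suc m) *_) (sym (recip-inverse (suc m))) ⟩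
  P (suc m) * (recip (suc m) * ι (suc (suc m)))
    ≡⟨ solve 3 (λ p t n → p :* (t :* n) := n :* (p :* t)) refl (P (suc m)) (recip (suc m)) (ι (suc (suc m))) ⟩
  ι (suc (suc m)) * tail (suc m)
    -- The shift by q only enlarges the denominator, so one bound serves every q.
    ≤⟨ *-monoʳ (0≤tail (suc m)) (≤-trans (p≤p+q {ι (suc (suc m))} (0≤ι q)) (≤-reflexive shift)) ⟩
  ι (suc (suc q ℕ.+ m)) * tail (suc m) ∎)
  (Bounded-mulXY m (0≤tail m) (Bounded-ratio q m))
  where
  open ≤-Reasoning
  n = ι (suc m)
  p = P m
  s = recip m
  shift : ι (suc (suc m)) + ι q ≡ ι (suc (suc q ℕ.+ m))
  shift = trans (sym (ι-+ (suc (suc m)) q)) (cong (ι ∘ suc ∘ suc) (ℕₚ.+-comm m q))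

Bounded-corner : ∀ q m → Bounded (corner q m) (2ℚ * (recip q * (2ℚ * (recip q * tail m))))
Bounded-corner q m = Bounded-flip (Bounded-divX-double q (0≤* 0≤2 (0≤* (0≤recip q) (0≤tail m)))
  (Bounded-flip (Bounded-divX-double q (0≤tail m) (Bounded-ratio q m))))

-- The sum telescopes by `tail-step`, starting from 4 `tail 0` = 4; hence the stronger invariant in
-- `go`.
sum-recip²P≤4 : ∀ N → sumBelow (λ i → recip i * recip i * P i) N ℚ.≤ 4ℚ
sum-recip²P≤4 N = ≤-trans (p≤p+q (0≤* 0≤4 (0≤tail N))) (go N)
  where
  open ≤-Reasoning
  go : ∀ N → sumBelow (λ i → recip i * recip i * P i) N + 4ℚ * tail N ℚ.≤ 4ℚ
  go zero    = ≤-refl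
  go (suc N) = begin
    x + t + 4ℚ * tail (suc N)    ≡⟨ +-assoc x t _ ⟩
    x + (t + 4ℚ * tail (suc N))  ≤⟨ +-monoʳ-≤ x (tail-step N) ⟩
    x + 4ℚ * tail N              ≤⟨ go N ⟩
    4ℚ                           ∎
    where
    x = sumBelow (λ i → recip i * recip i * P i) N
    t = recip N * recip N * P N

Bounded-sum : ∀ {f : ℕ → Series} {g : ℕ → ℚ} {c C} N → 0ℚ ℚ.≤ c →
              (∀ q → Bounded (f q) (c * g q)) → sumBelow g N ℚ.≤ C →
              Bounded (λ i j → sumBelow (λ q → f q i j) N) (c * C)
Bounded-sum {f} {g} {c} {C} N 0≤c hf hC = bounded λ i j → let w = 6^ (i ℕ.+ j) in begin
  ∣ sumBelow (λ q → f q i j) N ∣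
    ≤⟨ ∣sumBelow∣≤ (λ q → ≤-trans (bound (hf q) i j) (≤-reflexive
         (solve 3 (λ c g w → c :* g :* w := c :* w :* g) refl c (g q) w))) N ⟩
  sumBelow (λ q → c * w * g q) N
    ≡⟨ sumBelow-*ˡ (c * w) g N ⟩
  c * w * sumBelow g N
    ≤⟨ *-monoˡ (0≤* 0≤c (0≤6^ (i ℕ.+ j))) hC ⟩
  c * w * C
    ≡⟨ solve 3 (λ c w C → c :* w :* C := c :* C :* w) refl c w C ⟩
  c * C * w ∎
  where open ≤-Reasoning

-- The q-th corner is at most 4 `tail N` / (q + 1)². Inserting `P q` ≥ 1 bounds the sum of 1 / (q +
-- 1)² by 4, uniformly in K.
Bounded-cornerSum : ∀ K N → Bounded (λ i j → sumBelow (λ q → corner q N i j) K) (4ℚ * tail N * 4ℚ)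
Bounded-cornerSum K N = Bounded-sum {g = λ q → recip q * recip q} K (0≤* 0≤4 (0≤tail N))
  (λ q → subst (Bounded (corner q N)) (regroup (recip q) (tail N)) (Bounded-corner q N))
  (≤-trans (sumBelow-mono recip²≤ K) (sum-recip²P≤4 K))
  where
  regroup : ∀ s t → 2ℚ * (s * (2ℚ * (s * t))) ≡ 4ℚ * t * (s * s)
  regroup = solve 2 (λ s t → con 2ℚ :* (s :* (con 2ℚ :* (s :* t))) := con 4ℚ :* t :* (s :* s)) refl

  recip²≤ : ∀ q → recip q * recip q ℚ.≤ recip q * recip q * P q
  recip²≤ q = ≤-trans (≤-reflexive (sym (*-identityʳ (recip q * recip q))))
                      (*-monoˡ (0≤* (0≤recip q) (0≤recip q)) (1≤P q))

-- `ratio-shift` trades the denominator K + m + 1 - x for K + 1 - x: the latter yields `recip K`,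
-- while the shifted product decays like `tail m` and makes the sum over m converge. The bound is
-- uniform in M.
Bounded-connectedSum : ∀ K M → Bounded (connectedSum K M) (2ℚ * recip K * 4ℚ)
Bounded-connectedSum K M = Bounded-sum {g = λ m → recip m * recip m * P m} M
  (0≤* 0≤2 (0≤recip K)) (λ m → bounded (term m)) (sum-recip²P≤4 M)
  where
  open ≤-Reasoning
  term : ∀ m i j → ∣ recip m * divX (K ℕ.+ m) (ratio K m) i j ∣ ℚ.≤
                   2ℚ * recip K * (recip m * recip m * P m) * 6^ (i ℕ.+ j)
  term m i j = begin
    ∣ recip m * divX (K ℕ.+ m) (ratio K m) i j ∣
      ≡⟨ cong (λ z → ∣ recip m * z ∣) (ratio-shift K m i j) ⟩
    ∣ recip m * divX K (ratio (suc K) m) i j ∣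
      ≤⟨ ∣*∣≤ {recip m} {divX K (ratio (suc K) m) i j} (0≤recip m)
           (bound (Bounded-divX-double K (0≤tail m) (Bounded-ratio K m)) i j) ⟩
    recip m * (2ℚ * (recip K * (P m * recip m)) * 6^ (i ℕ.+ j))
      ≡⟨ solve 4 (λ s t p w → s :* (con 2ℚ :* (t :* (p :* s)) :* w) :=
                              con 2ℚ :* t :* (s :* s :* p) :* w) refl
           (recip m) (recip K) (P m) (6^ (i ℕ.+ j)) ⟩
    2ℚ * recip K * (recip m * recip m * P m) * 6^ (i ℕ.+ j) ∎

-- Passage to the limit

24ℚ : ℚ
24ℚ = ℤ.+ 24 / 1

-- Transport over N steps of sums cut at N leaves the errors r and e, at most 8 and 16 times 6^(i+j)
-- `tail N`; this is the origin of 24.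
S-zeta-bound : ∀ i j (2≤n : 2 ≤ 2 ℕ.+ (j ℕ.+ i)) N →
  ∣ seq (S (2 ℕ.+ (j ℕ.+ i)) (suc j)) N - seq (zeta (2 ℕ.+ (j ℕ.+ i)) 2≤n) N ∣ ℚ.≤
  24ℚ * 6^ (i ℕ.+ j) * tail N
S-zeta-bound i j 2≤n N = begin
  ∣ seq (S n (suc j)) N - z ∣
    ≡⟨ cong (λ x → ∣ x - z ∣) (trans (seq-S n (suc j) N) (trans (truncatedSum-indices i j N) transport)) ⟩
  ∣ r + (z - e) - z ∣
    ≡⟨ cong ∣_∣ (solve 3 (λ r z e → r :+ (z :- e) :- z := r :- e) refl r z e) ⟩
  ∣ r - e ∣
    ≤⟨ ∣-∣≤ {r} {e} (bound (Bounded-connectedSum N N) i j) (bound (Bounded-cornerSum N N) i j) ⟩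
  2ℚ * recip N * 4ℚ * w + 4ℚ * tail N * 4ℚ * w
    -- As `P N` ≥ 1, `recip N` is at most `tail N`, and both errors become multiples of one null
    -- sequence.
    ≤⟨ +-monoˡ-≤ _ (*-monoʳ (0≤6^ (i ℕ.+ j)) (*-monoʳ 0≤4 (*-monoˡ 0≤2 recip≤tail))) ⟩
  2ℚ * tail N * 4ℚ * w + 4ℚ * tail N * 4ℚ * w
    ≡⟨ solve 2 (λ t w → con 2ℚ :* t :* con 4ℚ :* w :+ con 4ℚ :* t :* con 4ℚ :* w :=
                        con 24ℚ :* w :* t) refl (tail N) w ⟩
  24ℚ * w * tail N ∎
  where
  open ≤-Reasoning
  n = 2 ℕ.+ (j ℕ.+ i)
  w = 6^ (i ℕ.+ j)
  z = sumBelow (λ q → recipPow q n) N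
  r = connectedSum N N i j
  e = sumBelow (λ q → corner q N i j) N
  transport : connectedSum 0 N i j ≡ r + (z - e)
  transport = trans (connectedSum-transport N N i j)
    (cong (λ a → r + (a - e)) (sumBelow-cong (λ q → corner-0 q i j) N))
  recip≤tail : recip N ℚ.≤ tail N
  recip≤tail = ≤-trans (≤-reflexive (sym (*-identityˡ (recip N)))) (*-monoʳ (0≤recip N) (1≤P N))

-- `tail-small` provides a single index; monotonicity of `tail` extends the estimate to all later
-- ones.
tail-vanishes : ∀ C → 0ℚ ℚ.< C → ∀ ε → 0ℚ ℚ.< ε → ∃[ N ] (∀ n → N ≤ n → C * tail n ℚ.< ε)
tail-vanishes C 0<C ε 0<ε =
  let N , small = tail-small (C⁻¹ * ε) (0<* (positive⁻¹ C⁻¹ {{1/pos⇒pos C}}) 0<ε)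
  in N , λ n N≤n → ≤-<-trans (*-monoˡ (<⇒≤ 0<C) (tail-antitone N≤n)) (rescale (tail N) small)
  where
  instance
    C-positive : Positive C
    C-positive = positive 0<C

    C-nonZero : NonZero C
    C-nonZero = pos⇒nonZero C

  C⁻¹ : ℚ
  C⁻¹ = 1/ C

  rescale : ∀ t → t ℚ.< C⁻¹ * ε → C * t ℚ.< ε
  rescale t t< = begin-strict
    C * t          <⟨ *-monoʳ-<-pos C t< ⟩
    C * (C⁻¹ * ε)  ≡⟨ sym (*-assoc C C⁻¹ ε) ⟩
    C * C⁻¹ * ε    ≡⟨ cong (_* ε) (*-inverseʳ C) ⟩
    1ℚ * ε         ≡⟨ *-identityˡ ε ⟩
    ε              ∎
    where open ≤-Reasoning

S≈zeta : ∀ i j (2≤n : 2 ≤ 2 ℕ.+ (j ℕ.+ i)) →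
         S (2 ℕ.+ (j ℕ.+ i)) (suc j) ≈ℝ zeta (2 ℕ.+ (j ℕ.+ i)) 2≤n
S≈zeta i j 2≤n ε 0<ε =
  let C = 24ℚ * 6^ (i ℕ.+ j)
      N , small = tail-vanishes C (0<* (positive⁻¹ 24ℚ) (0<6^ (i ℕ.+ j))) ε 0<ε
  in N , λ m N≤m → ≤-<-trans (S-zeta-bound i j 2≤n m) (small m N≤m)

mainTheorem1 : (n r : ℕ) (2≤n : 2 ≤ n) → 1 ≤ r → r < n → S n r ≈ℝ zeta n 2≤n
mainTheorem1 n (suc j) 2≤n _ r<n = go 2≤n (ℕₚ.m≤n⇒∃[o]m+o≡n r<n)
  where
  -- Here n is general so that matching `refl` can replace it by 2 + (j + i); the difference i = n -
  -- r - 1 is the exponent of x.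
  go : ∀ {n} (2≤n : 2 ≤ n) → ∃[ i ] 2 ℕ.+ (j ℕ.+ i) ≡ n → S n (suc j) ≈ℝ zeta n 2≤n
  go 2≤n (i , refl) = S≈zeta i j 2≤n
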